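{- Let ${\cal F}$ be a nonprincipal filter on $\omega$, and for sequences $\hat s=\{s_n\}$ with $s_n\in(0,\tfrac12]$ let $\mu_{\hat s}$ denote the corresponding product measure on $2^\omega$. (1) If $\hat p,\hat q$ are such sequences with $p_n\le q_n$ for all but finitely many $n$, and $\mu_{\hat q}({\cal F})=0$, then $\mu_{\hat p}({\cal F})=0$. (2) If ${\cal F}$ is nonmeasurable with respect to both $\mu_{\hat p}$ and $\mu_{\hat q}$, and $r_n=\min\{p_n,q_n\}$ for $n\in\omega$, then ${\cal F}$ is $\mu_{\hat r}$-nonmeasurable.
   Context: Subsets of $\omega$ are identified with their characteristic functions, so filters on $\omega$ are subsets of $2^\omega$. For $\hat s=\{s_n:n\in\omega\}$ with $s_n\in(0,\tfrac12]$, $\mu_{\hat s}$ is the product measure on $2^\omega$ with $\mu_{\hat s}(\{x:x(n)=1\})=s_n$ and $\mu_{\hat s}(\{x:x(n)=0\})=1-s_n$. -}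

module Defs where

open import Level using (0ℓ)
open import Data.Bool.Base using (Bool; true; false; if_then_else_; _∧_)
open import Data.Empty using (⊥)
open import Data.List.Base using (List; []; _∷_)
open import Data.Maybe.Base using (Maybe; just; nothing; maybe′)
open import Data.Nat.Base as ℕ using (ℕ; zero; suc)
import Data.Nat.Properties as ℕ
open import Data.Product.Base using (∃-syntax; _×_; _,_)
open import Data.Rational.Base as ℚ using (ℚ; 0ℚ; 1ℚ; ½)
import Data.Rational.Properties as ℚ
open import Data.Rational.Solver using (module +-*-Solver)
open import Data.Sum.Base using (inj₁; inj₂)
open import Data.Unit.Base using (⊤)
open import Function.Base using (_∘_)
open import Function.Bundles using (_⇔_)
open import Relation.Binary.PropositionalEquality
  using (_≡_; refl; sym; trans; cong; subst)
open import Relation.Nullary.Negation using (¬_)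
open import Relation.Unary using (Pred; _∩_; ∁)

-- Real numbers: Cauchy sequences of rationals, compared up to _≈_.

IsCauchy : (ℕ → ℚ) → Set
IsCauchy x = ∀ ε → 0ℚ ℚ.< ε →
  ∃[ N ] (∀ m n → N ℕ.≤ m → N ℕ.≤ n → ℚ.∣ x m ℚ.- x n ∣ ℚ.≤ ε)

record ℝ : Set where
  constructor mkℝ
  field
    seq    : ℕ → ℚ
    cauchy : IsCauchy seq

open ℝ public

infix 4 _≤_ _<_ _≈_
infixl 6 _+_ _-_
infixl 7 _*_ _⊓_
infix 8 -_

_≤_ : ℝ → ℝ → Set
x ≤ y = ∀ ε → 0ℚ ℚ.< ε → ∃[ N ] (∀ n → N ℕ.≤ n → seq x n ℚ.≤ seq y n ℚ.+ ε)

_<_ : ℝ → ℝ → Set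
x < y = ∃[ ε ] (0ℚ ℚ.< ε × ∃[ N ] (∀ n → N ℕ.≤ n → seq x n ℚ.+ ε ℚ.≤ seq y n))

_≈_ : ℝ → ℝ → Set
x ≈ y = x ≤ y × y ≤ x

private
 open +-*-Solver

 -- abstract, so that normalising a real number does not unfold these proofs
 abstract
  0<½* : ∀ ε → 0ℚ ℚ.< ε → 0ℚ ℚ.< ½ ℚ.* ε
  0<½* ε 0<ε = ℚ.positive⁻¹ _
    {{ℚ.pos*pos⇒pos ½ ε {{ℚ.positive 0<ε}}}}

  ½+½ : ∀ ε → ½ ℚ.* ε ℚ.+ ½ ℚ.* ε ≡ ε
  ½+½ ε = trans (sym (ℚ.*-distribʳ-+ ε ½ ½)) (ℚ.*-identityˡ ε)

  p≤∣p∣ : ∀ p → p ℚ.≤ ℚ.∣ p ∣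
  p≤∣p∣ p with ℚ.≤-total 0ℚ p
  ... | inj₁ 0≤p = ℚ.≤-reflexive (sym (ℚ.0≤p⇒∣p∣≡p 0≤p))
  ... | inj₂ p≤0 = ℚ.≤-trans p≤0 (ℚ.0≤∣p∣ p)

  ∣∣-intro : ∀ p {ε} → p ℚ.≤ ε → ℚ.- p ℚ.≤ ε → ℚ.∣ p ∣ ℚ.≤ ε
  ∣∣-intro p h₁ h₂ with ℚ.∣p∣≡p∨∣p∣≡-p p
  ... | inj₁ e = subst (ℚ._≤ _) (sym e) h₁
  ... | inj₂ e = subst (ℚ._≤ _) (sym e) h₂

  a≤b+ε⇒a-b≤ε : ∀ a b {ε} → a ℚ.≤ b ℚ.+ ε → a ℚ.- b ℚ.≤ ε
  a≤b+ε⇒a-b≤ε a b {ε} h = subst (a ℚ.- b ℚ.≤_)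
    (solve 2 (λ b ε → (b :+ ε) :- b := ε) refl b ε) (ℚ.+-monoˡ-≤ (ℚ.- b) h)

  ∣a-b∣-intro : ∀ a b {ε} → a ℚ.≤ b ℚ.+ ε → b ℚ.≤ a ℚ.+ ε → ℚ.∣ a ℚ.- b ∣ ℚ.≤ ε
  ∣a-b∣-intro a b {ε} h₁ h₂ = ∣∣-intro (a ℚ.- b) (a≤b+ε⇒a-b≤ε a b h₁)
    (subst (ℚ._≤ ε) (solve 2 (λ a b → b :- a := :- (a :- b)) refl a b)
      (a≤b+ε⇒a-b≤ε b a h₂))

  ∣a-b∣-elim : ∀ a b {ε} → ℚ.∣ a ℚ.- b ∣ ℚ.≤ ε → a ℚ.≤ b ℚ.+ ε
  ∣a-b∣-elim a b {ε} h = subst (ℚ._≤ b ℚ.+ ε)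
    (solve 2 (λ a b → b :+ (a :- b) := a) refl a b)
    (ℚ.+-monoʳ-≤ b (ℚ.≤-trans (p≤∣p∣ (a ℚ.- b)) h))

  ∣a-b∣-sym : ∀ a b → ℚ.∣ a ℚ.- b ∣ ≡ ℚ.∣ b ℚ.- a ∣
  ∣a-b∣-sym a b = trans (sym (ℚ.∣-p∣≡∣p∣ (a ℚ.- b)))
    (cong ℚ.∣_∣ (solve 2 (λ a b → :- (a :- b) := b :- a) refl a b))

  const-cauchy : ∀ q → IsCauchy (λ _ → q)
  const-cauchy q ε 0<ε = 0 , λ _ _ _ _ →
    subst (ℚ._≤ ε) (cong ℚ.∣_∣ (sym (ℚ.+-inverseʳ q))) (ℚ.<⇒≤ 0<ε)

  +-cauchy : ∀ x y → IsCauchy x → IsCauchy y → IsCauchy (λ n → x n ℚ.+ y n)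
  +-cauchy x y cx cy ε 0<ε
    with cx (½ ℚ.* ε) (0<½* ε 0<ε) | cy (½ ℚ.* ε) (0<½* ε 0<ε)
  ... | M , hx | N , hy = M ℕ.⊔ N , λ m n lm ln →
    let M≤ = λ {k} → ℕ.≤-trans {k = k} (ℕ.m≤m⊔n M N)
        N≤ = λ {k} → ℕ.≤-trans {k = k} (ℕ.m≤n⊔m M N)
    in subst (ℚ._≤ ε)
      (cong ℚ.∣_∣ (solve 4 (λ a b c d → (a :- c) :+ (b :- d) := (a :+ b) :- (c :+ d))
        refl (x m) (y m) (x n) (y n)))
      (ℚ.≤-trans (ℚ.∣p+q∣≤∣p∣+∣q∣ (x m ℚ.- x n) (y m ℚ.- y n))
        (subst (_ ℚ.≤_) (½+½ ε)
          (ℚ.+-mono-≤ (hx m n (M≤ lm) (M≤ ln)) (hy m n (N≤ lm) (N≤ ln)))))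

  neg-cauchy : ∀ x → IsCauchy x → IsCauchy (λ n → ℚ.- x n)
  neg-cauchy x cx ε 0<ε with cx ε 0<ε
  ... | N , hx = N , λ m n lm ln → subst (ℚ._≤ ε)
    (trans (sym (ℚ.∣-p∣≡∣p∣ (x m ℚ.- x n)))
      (cong ℚ.∣_∣ (solve 2 (λ a b → :- (a :- b) := (:- a) :- (:- b)) refl (x m) (x n))))
    (hx m n lm ln)

  ⊓-cauchy : ∀ x y → IsCauchy x → IsCauchy y → IsCauchy (λ n → x n ℚ.⊓ y n)
  ⊓-cauchy x y cx cy ε 0<ε with cx ε 0<ε | cy ε 0<ε
  ... | M , hx | N , hy = M ℕ.⊔ N , λ m n lm ln →
    ∣a-b∣-intro (x m ℚ.⊓ y m) (x n ℚ.⊓ y n) (half m n lm ln) (half n m ln lm)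
    where
    half : ∀ m n → M ℕ.⊔ N ℕ.≤ m → M ℕ.⊔ N ℕ.≤ n →
           x m ℚ.⊓ y m ℚ.≤ (x n ℚ.⊓ y n) ℚ.+ ε
    half m n lm ln = subst (x m ℚ.⊓ y m ℚ.≤_)
      (sym (ℚ.mono-≤-distrib-⊓ {f = ℚ._+ ε} (ℚ.+-monoˡ-≤ ε) (x n) (y n)))
      (ℚ.⊓-mono-≤
        (∣a-b∣-elim (x m) (x n) (hx m n (ℕ.≤-trans (ℕ.m≤m⊔n M N) lm) (ℕ.≤-trans (ℕ.m≤m⊔n M N) ln)))
        (∣a-b∣-elim (y m) (y n) (hy m n (ℕ.≤-trans (ℕ.m≤n⊔m M N) lm) (ℕ.≤-trans (ℕ.m≤n⊔m M N) ln))))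

  eventually-bounded : ∀ x → IsCauchy x →
    ∃[ B ] (0ℚ ℚ.< B × ∃[ N ] (∀ n → N ℕ.≤ n → ℚ.∣ x n ∣ ℚ.≤ B))
  eventually-bounded x cx with cx 1ℚ (ℚ.positive⁻¹ 1ℚ)
  ... | N , h = ℚ.∣ x N ∣ ℚ.+ 1ℚ
    , ℚ.+-mono-≤-< (ℚ.0≤∣p∣ (x N)) (ℚ.positive⁻¹ 1ℚ)
    , N , λ n l → subst (ℚ._≤ ℚ.∣ x N ∣ ℚ.+ 1ℚ)
      (cong ℚ.∣_∣ (solve 2 (λ a b → b :+ (a :- b) := a) refl (x n) (x N)))
      (ℚ.≤-trans (ℚ.∣p+q∣≤∣p∣+∣q∣ (x N) (x n ℚ.- x N))
        (ℚ.+-monoʳ-≤ ℚ.∣ x N ∣ (h n N l ℕ.≤-refl)))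

  ∣*∣-bound : ∀ p q {A B} → ℚ.∣ p ∣ ℚ.≤ A → 0ℚ ℚ.< A → ℚ.∣ q ∣ ℚ.≤ B →
              ℚ.∣ p ℚ.* q ∣ ℚ.≤ A ℚ.* B
  ∣*∣-bound p q {A} {B} hp 0<A hq = subst (ℚ._≤ A ℚ.* B) (sym (ℚ.∣p*q∣≡∣p∣*∣q∣ p q))
    (ℚ.≤-trans
      (ℚ.*-monoʳ-≤-nonNeg ℚ.∣ q ∣ {{ℚ.nonNegative (ℚ.0≤∣p∣ q)}} hp)
      (ℚ.*-monoˡ-≤-nonNeg A {{ℚ.nonNegative (ℚ.<⇒≤ 0<A)}} hq))

  reciprocal : ∀ c → 0ℚ ℚ.< c → ∃[ d ] (0ℚ ℚ.< d × c ℚ.* d ≡ 1ℚ)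
  reciprocal c 0<c = ℚ.1/ c , ℚ.positive⁻¹ (ℚ.1/ c) {{ℚ.1/pos⇒pos c}} , ℚ.*-inverseʳ c
    where
    instance
      c>0 : ℚ.Positive c
      c>0 = ℚ.positive 0<c
      c≢0 : ℚ.NonZero c
      c≢0 = ℚ.pos⇒nonZero c

  split : ∀ A B ε → 0ℚ ℚ.< A → 0ℚ ℚ.< B → 0ℚ ℚ.< ε →
          ∃[ δ ] (0ℚ ℚ.< δ × A ℚ.* δ ℚ.+ B ℚ.* δ ≡ ε)
  split A B ε 0<A 0<B 0<ε with reciprocal (A ℚ.+ B) (ℚ.+-mono-< 0<A 0<B)
  ... | d , 0<d , e = d ℚ.* ε
    , ℚ.positive⁻¹ _ {{ℚ.pos*pos⇒pos d {{ℚ.positive 0<d}} ε {{ℚ.positive 0<ε}}}}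
    , trans (sym (ℚ.*-distribʳ-+ (d ℚ.* ε) A B))
      (trans (sym (ℚ.*-assoc (A ℚ.+ B) d ε))
        (trans (cong (ℚ._* ε) e) (ℚ.*-identityˡ ε)))

  ∣ab-cd∣-bound : ∀ a b c d {A B δ} → 0ℚ ℚ.< A → 0ℚ ℚ.< B →
    ℚ.∣ a ∣ ℚ.≤ A → ℚ.∣ d ∣ ℚ.≤ B →
    ℚ.∣ a ℚ.- c ∣ ℚ.≤ δ → ℚ.∣ b ℚ.- d ∣ ℚ.≤ δ →
    ℚ.∣ a ℚ.* b ℚ.- c ℚ.* d ∣ ℚ.≤ A ℚ.* δ ℚ.+ B ℚ.* δ
  ∣ab-cd∣-bound a b c d {A} {B} {δ} 0<A 0<B ha hd hac hbd =
    subst (ℚ._≤ A ℚ.* δ ℚ.+ B ℚ.* δ)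
      (cong ℚ.∣_∣ (solve 4 (λ a b c d → a :* (b :- d) :+ d :* (a :- c) := a :* b :- c :* d)
        refl a b c d))
      (ℚ.≤-trans (ℚ.∣p+q∣≤∣p∣+∣q∣ (a ℚ.* (b ℚ.- d)) (d ℚ.* (a ℚ.- c)))
        (ℚ.+-mono-≤ (∣*∣-bound a (b ℚ.- d) ha 0<A hbd) (∣*∣-bound d (a ℚ.- c) hd 0<B hac)))

  *-cauchy : ∀ x y → IsCauchy x → IsCauchy y → IsCauchy (λ n → x n ℚ.* y n)
  *-cauchy x y cx cy ε 0<ε =
    let (A , 0<A , K , bx) = eventually-bounded x cx
        (B , 0<B , L , by) = eventually-bounded y cy
        (δ , 0<δ , Aδ+Bδ≡ε) = split A B ε 0<A 0<B 0<ε
        (M , hx) = cx δ 0<δ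
        (N , hy) = cy δ 0<δ
        KL : ∀ {k} → (K ℕ.⊔ L) ℕ.⊔ (M ℕ.⊔ N) ℕ.≤ k → K ℕ.⊔ L ℕ.≤ k
        KL = ℕ.m⊔n≤o⇒m≤o (K ℕ.⊔ L) (M ℕ.⊔ N)
        MN : ∀ {k} → (K ℕ.⊔ L) ℕ.⊔ (M ℕ.⊔ N) ℕ.≤ k → M ℕ.⊔ N ℕ.≤ k
        MN = ℕ.m⊔n≤o⇒n≤o (K ℕ.⊔ L) (M ℕ.⊔ N)
    in (K ℕ.⊔ L) ℕ.⊔ (M ℕ.⊔ N) , λ m n lm ln →
      subst (ℚ.∣ x m ℚ.* y m ℚ.- x n ℚ.* y n ∣ ℚ.≤_) Aδ+Bδ≡ε
        (∣ab-cd∣-bound (x m) (y m) (x n) (y n) 0<A 0<B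
          (bx m (ℕ.m⊔n≤o⇒m≤o K L (KL lm))) (by n (ℕ.m⊔n≤o⇒n≤o K L (KL ln)))
          (hx m n (ℕ.m⊔n≤o⇒m≤o M N (MN lm)) (ℕ.m⊔n≤o⇒m≤o M N (MN ln)))
          (hy m n (ℕ.m⊔n≤o⇒n≤o M N (MN lm)) (ℕ.m⊔n≤o⇒n≤o M N (MN ln))))

fromℚ : ℚ → ℝ
fromℚ q = mkℝ (λ _ → q) (const-cauchy q)

0ℝ 1ℝ ½ℝ : ℝ
0ℝ = fromℚ 0ℚ
1ℝ = fromℚ 1ℚ
½ℝ = fromℚ ½

-_ : ℝ → ℝ
- x = mkℝ (λ n → ℚ.- seq x n) (neg-cauchy (seq x) (cauchy x))

_+_ _*_ _-_ _⊓_ : ℝ → ℝ → ℝ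
x + y = mkℝ (λ n → seq x n ℚ.+ seq y n) (+-cauchy (seq x) (seq y) (cauchy x) (cauchy y))
x * y = mkℝ (λ n → seq x n ℚ.* seq y n) (*-cauchy (seq x) (seq y) (cauchy x) (cauchy y))
x - y = x + (- y)
x ⊓ y = mkℝ (λ n → seq x n ℚ.⊓ seq y n) (⊓-cauchy (seq x) (seq y) (cauchy x) (cauchy y))

IsSupremum : ∀ {ℓ} → Pred ℝ ℓ → ℝ → Set ℓ
IsSupremum P v = (∀ w → P w → w ≤ v) × (∀ u → (∀ w → P w → w ≤ u) → v ≤ u)

IsInfimum : ∀ {ℓ} → Pred ℝ ℓ → ℝ → Set ℓ
IsInfimum P v = (∀ w → P w → v ≤ w) × (∀ u → (∀ w → P w → u ≤ w) → u ≤ v)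

partialSum : (ℕ → ℝ) → ℕ → ℝ
partialSum f zero    = 0ℝ
partialSum f (suc n) = partialSum f n + f n

-- For series of nonnegative terms, the only ones used below.
HasSum : (ℕ → ℝ) → ℝ → Set
HasSum f = IsSupremum (λ w → ∃[ n ] w ≈ partialSum f n)

Cantor : Set
Cantor = ℕ → Bool

-- x lies in the basic clopen set of sequences extending the finite sequence σ.
_Extends_ : Cantor → List Bool → Set
x Extends []      = ⊤
x Extends (b ∷ σ) = x 0 ≡ b × (x ∘ suc) Extends σ

IsWeight : (ℕ → ℝ) → Set
IsWeight s = ∀ n → 0ℝ < s n × s n ≤ ½ℝ

cylinderMeasure : (ℕ → ℝ) → List Bool → ℝ
cylinderMeasure s []      = 1ℝ
cylinderMeasure s (b ∷ σ) =
  (if b then s 0 else 1ℝ - s 0) * cylinderMeasure (s ∘ suc) σ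

-- The product measure is the Carathéodory extension of cylinderMeasure: the
-- restriction to the measurable sets of the outer measure it generates.  This
-- is the completed measure.  In covers, nothing stands for the empty set.

Covers : (ℕ → Maybe (List Bool)) → Pred Cantor 0ℓ → Set
Covers c A = ∀ x → A x → ∃[ n ] maybe′ (x Extends_) ⊥ (c n)

IsOuterMeasure : (ℕ → ℝ) → Pred Cantor 0ℓ → ℝ → Set
IsOuterMeasure s A = IsInfimum λ v → ∃[ c ]
  (Covers c A × HasSum (maybe′ (cylinderMeasure s) 0ℝ ∘ c) v)

-- Under excluded middle every set has an outer measure, so the three
-- hypotheses on a, b and c merely name the numbers.
Measurable : (ℕ → ℝ) → Pred Cantor 0ℓ → Set₁
Measurable s A = ∀ (E : Pred Cantor 0ℓ) a b c →
  IsOuterMeasure s E a →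
  IsOuterMeasure s (E ∩ A) b →
  IsOuterMeasure s (E ∩ ∁ A) c →
  a ≈ b + c

HasMeasure : (ℕ → ℝ) → Pred Cantor 0ℓ → ℝ → Set₁
HasMeasure s A v = Measurable s A × IsOuterMeasure s A v

_⊑_ : Cantor → Cantor → Set
X ⊑ Y = ∀ n → X n ≡ true → Y n ≡ true

record IsFilter (F : Pred Cantor 0ℓ) : Set where
  field
    whole  : F (λ _ → true)
    proper : ¬ F (λ _ → false)
    upward : ∀ {X Y} → F X → X ⊑ Y → F Y
    meet   : ∀ {X Y} → F X → F Y → F (λ n → X n ∧ Y n)

Principal : Pred Cantor 0ℓ → Set
Principal F = ∃[ A ] (∀ X → F X ⇔ A ⊑ X)

record IsNonprincipalFilter (F : Pred Cantor 0ℓ) : Set where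
  field
    isFilter     : IsFilter F
    nonprincipal : ¬ Principal F

{-# OPTIONS --safe #-}
module Submission where

open import Defs
open import Level using (0ℓ)
open import Axiom.ExcludedMiddle using (ExcludedMiddle)
open import Data.Bool.Base using (Bool; true; false; if_then_else_; _∧_; T)
open import Data.Empty using (⊥; ⊥-elim)
import Data.Integer.Base as ℤ
import Data.Integer.Properties as ℤ
open import Data.List.Base using (List; []; _∷_; _∷ʳ_; length)
open import Data.Maybe.Base as Maybe using (Maybe; just; nothing; maybe′)
open import Data.Nat.Base as ℕ using (ℕ; zero; suc)
import Data.Nat.Coprimality as ℕ
import Data.Nat.Properties as ℕ
open import Data.Product.Base using (∃-syntax; Σ-syntax; _×_; _,_; proj₁; proj₂)
open import Data.Rational.Base as ℚ using (ℚ; mkℚ; 0ℚ; 1ℚ; ½)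
import Data.Rational.Properties as ℚ
open import Data.Rational.Solver using (module +-*-Solver)
import Data.Rational.Unnormalised.Base as ℚᵘ
import Data.Rational.Unnormalised.Properties as ℚᵘ
open import Data.Sum.Base using (_⊎_; inj₁; inj₂; [_,_]′)
open import Data.Unit.Base using (⊤; tt)
open import Function.Base using (_∘_; case_of_)
open import Function.Bundles using (mk⇔)
open import Relation.Binary.PropositionalEquality
  using (_≡_; refl; sym; trans; cong; cong₂; subst; subst₂)
open import Relation.Nullary.Decidable using (Dec; does; yes; no; decidable-stable)
open import Relation.Nullary.Negation using (¬_)
open import Relation.Unary using (Pred; _∩_; ∁)

open +-*-Solver

-- A set is null for a product measure iff it has covers by cylinders of arbitrarily
-- small total mass.  If X ~ s and Z is a random sequence whose bits depend on those of X,
-- then a cover c for the law of Z induces the martingale of the conditional expected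
-- number of cylinders of c that contain Z, given finitely many bits of X.  By Ville's
-- inequality the X at which it ever reaches t are covered by cylinders of mass ≤ v / t,
-- where v is the total mass of c.
--
-- (1) After changing finitely many weights, p ≤ q, and a sequence with law p has a
-- random extension Z with law q.  If X is in F, so is Z, whence a cover of F catches Z
-- with probability one.
--
-- (2) Let r = p on A and r = q off A.  If X and Y belong to F, so does the sequence Z
-- equal to X on A and to Y off A, and Z has law r if X and Y are independent with laws p
-- and q.  Applying the inequality twice, F null for r forces F null for p or for q.
-- So it suffices that a measurable F is null for r.  Otherwise its complement has a
-- cover of mass < 1, and since r ≤ ½ one may couple two sequences with law r that agree
-- up to some L and are disjoint afterwards, so that with positive probability both avoid
-- the cover.  Their meet is a finite set in F, and F is principal.

-- Arithmetic of rationals and reals.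

module Reals where

  abstract

    0≤+ℚ : ∀ {a b} → 0ℚ ℚ.≤ a → 0ℚ ℚ.≤ b → 0ℚ ℚ.≤ a ℚ.+ b
    0≤+ℚ = ℚ.+-mono-≤

    0≤*ℚ : ∀ {a b} → 0ℚ ℚ.≤ a → 0ℚ ℚ.≤ b → 0ℚ ℚ.≤ a ℚ.* b
    0≤*ℚ {a} {b} ha hb = ℚ.nonNegative⁻¹ _
      {{ℚ.nonNeg*nonNeg⇒nonNeg a {{ℚ.nonNegative ha}} b {{ℚ.nonNegative hb}}}}

    0<*ℚ : ∀ {a b} → 0ℚ ℚ.< a → 0ℚ ℚ.< b → 0ℚ ℚ.< a ℚ.* b
    0<*ℚ {a} {b} ha hb = ℚ.positive⁻¹ _
      {{ℚ.pos*pos⇒pos a {{ℚ.positive ha}} b {{ℚ.positive hb}}}}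

    -- Inequalities are mostly proved by exhibiting the slack z: its nonnegativity is assembled from
    -- the hypotheses, and a ring identity is left to the solver. `≼-from-difference` does the same
    -- for reals.
    ≤-fromℚ-difference : ∀ {a b} z → 0ℚ ℚ.≤ z → a ℚ.+ z ≡ b → a ℚ.≤ b
    ≤-fromℚ-difference {a} z hz refl =
      subst (ℚ._≤ a ℚ.+ z) (ℚ.+-identityʳ a) (ℚ.+-monoʳ-≤ a hz)

    0≤difference : ∀ {a b} → a ℚ.≤ b → 0ℚ ℚ.≤ b ℚ.- a
    0≤difference {a} {b} h =
      subst (ℚ._≤ b ℚ.- a) (ℚ.+-inverseʳ a) (ℚ.+-monoˡ-≤ (ℚ.- a) h)

    0<½ℚ : 0ℚ ℚ.< ½
    0<½ℚ = ℚ.positive⁻¹ ½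

    0<1ℚ : 0ℚ ℚ.< 1ℚ
    0<1ℚ = ℚ.positive⁻¹ 1ℚ

    0<½*ℚ : ∀ {ε} → 0ℚ ℚ.< ε → 0ℚ ℚ.< ½ ℚ.* ε
    0<½*ℚ = 0<*ℚ 0<½ℚ

    ½+½ : ∀ ε → ½ ℚ.* ε ℚ.+ ½ ℚ.* ε ≡ ε
    ½+½ ε = trans (sym (ℚ.*-distribʳ-+ ε ½ ½)) (ℚ.*-identityˡ ε)

    reciprocalℚ : ∀ {c} → 0ℚ ℚ.< c → ∃[ d ] (0ℚ ℚ.< d × c ℚ.* d ≡ 1ℚ)
    reciprocalℚ {c} 0<c = ℚ.1/ c , ℚ.positive⁻¹ (ℚ.1/ c) {{ℚ.1/pos⇒pos c}} , ℚ.*-inverseʳ c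
      where
      instance
        c>0 : ℚ.Positive c
        c>0 = ℚ.positive 0<c
        c≢0 : ℚ.NonZero c
        c≢0 = ℚ.pos⇒nonZero c

    p≤∣p∣ : ∀ p → p ℚ.≤ ℚ.∣ p ∣
    p≤∣p∣ p with ℚ.≤-total 0ℚ p
    ... | inj₁ 0≤p = ℚ.≤-reflexive (sym (ℚ.0≤p⇒∣p∣≡p 0≤p))
    ... | inj₂ p≤0 = ℚ.≤-trans p≤0 (ℚ.0≤∣p∣ p)

    ∣a-b∣≤⇒a≤b+ : ∀ a b {ε} → ℚ.∣ a ℚ.- b ∣ ℚ.≤ ε → a ℚ.≤ b ℚ.+ ε
    ∣a-b∣≤⇒a≤b+ a b {ε} h = subst (ℚ._≤ b ℚ.+ ε)
      (solve 2 (λ a b → b :+ (a :- b) := a) refl a b)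
      (ℚ.+-monoʳ-≤ b (ℚ.≤-trans (p≤∣p∣ (a ℚ.- b)) h))

    a≤b+⇒∣a-b∣≤ : ∀ a b {ε} → a ℚ.≤ b ℚ.+ ε → b ℚ.≤ a ℚ.+ ε → ℚ.∣ a ℚ.- b ∣ ℚ.≤ ε
    a≤b+⇒∣a-b∣≤ a b {ε} h₁ h₂ with ℚ.∣p∣≡p∨∣p∣≡-p (a ℚ.- b)
    ... | inj₁ e = subst (ℚ._≤ ε) (sym e) (≤-fromℚ-difference _ (0≤difference h₁)
      (solve 3 (λ a b e → a :- b :+ (b :+ e :- a) := e) refl a b ε))
    ... | inj₂ e = subst (ℚ._≤ ε) (sym e) (≤-fromℚ-difference _ (0≤difference h₂)
      (solve 3 (λ a b e → :- (a :- b) :+ (a :+ e :- b) := e) refl a b ε))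

    multiple : ℕ → ℚ → ℚ
    multiple zero    ε = 0ℚ
    multiple (suc n) ε = ε ℚ.+ multiple n ε

    -- Given in normal form, so that in `≤fromℕ` the comparison reduces to one between integers: a
    -- denominator is at least one.
    fromℕ : ℕ → ℚ
    fromℕ n = mkℚ (ℤ.+ n) 0 (ℕ.sym (ℕ.1-coprimeTo n))

    fromℕ≤multiple : ∀ n → fromℕ n ℚ.≤ multiple n 1ℚ
    fromℕ≤multiple zero    = ℚ.≤-refl
    fromℕ≤multiple (suc n) = ℚ.≤-trans
      (ℚ.toℚᵘ-cancel-≤ (ℚᵘ.≤-respʳ-≃ (ℚᵘ.≃-sym (ℚ.toℚᵘ-homo-+ 1ℚ (fromℕ n)))
        (ℚᵘ.*≤* (ℤ.≤-reflexive (cong (ℤ._* ℤ.+ 1) (cong (ℤ._+_ (ℤ.+ 1)) (sym (ℤ.*-identityʳ (ℤ.+ n)))))))))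
      (ℚ.+-monoʳ-≤ 1ℚ (fromℕ≤multiple n))

    ≤fromℕ : ∀ p → ∃[ n ] p ℚ.≤ fromℕ n
    ≤fromℕ (mkℚ (ℤ.+ n) d _)      = n , ℚ.*≤* (ℤ.*-monoˡ-≤-nonNeg (ℤ.+ n) (ℤ.+≤+ (ℕ.s≤s ℕ.z≤n)))
    ≤fromℕ (mkℚ ℤ.-[1+ n ] d _) = 0 , ℚ.*≤* ℤ.-≤+

    multiple-* : ∀ n ε → multiple n ε ≡ multiple n 1ℚ ℚ.* ε
    multiple-* zero    ε = sym (ℚ.*-zeroˡ ε)
    multiple-* (suc n) ε = trans (cong (ε ℚ.+_) (multiple-* n ε))
      (solve 2 (λ e m → e :+ m :* e := (con 1ℚ :+ m) :* e) refl ε (multiple n 1ℚ))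

    archimedean : ∀ w {ε} → 0ℚ ℚ.< ε → ∃[ n ] w ℚ.≤ multiple n ε
    archimedean w {ε} 0<ε with reciprocalℚ 0<ε
    ... | d , 0<d , e with ≤fromℕ (w ℚ.* d)
    ... | n , h = n , subst₂ ℚ._≤_
      (trans (ℚ.*-assoc w d ε) (trans (cong (w ℚ.*_) (trans (ℚ.*-comm d ε) e)) (ℚ.*-identityʳ w)))
      (sym (multiple-* n ε))
      (ℚ.*-monoʳ-≤-nonNeg ε {{ℚ.nonNegative (ℚ.<⇒≤ 0<ε)}} (ℚ.≤-trans h (fromℕ≤multiple n)))

    halved : ℕ → ℚ → ℚ
    halved zero    w = w
    halved (suc n) w = ½ ℚ.* halved n w

    -- This and `halved-suc` give the defining equations of the abstract `halved` as propositions,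
    -- for use in `width`.
    halved-zero : ∀ w → w ≡ halved 0 w
    halved-zero w = refl

    halved-suc : ∀ n w → ½ ℚ.* halved n w ≡ halved (suc n) w
    halved-suc n w = refl

    halved-½ : ∀ n w → halved (suc n) w ≡ halved n (½ ℚ.* w)
    halved-½ zero    w = refl
    halved-½ (suc n) w = cong (½ ℚ.*_) (halved-½ n w)

    0≤multiple : ∀ n {ε} → 0ℚ ℚ.≤ ε → 0ℚ ℚ.≤ multiple n ε
    0≤multiple zero    h = ℚ.≤-refl
    0≤multiple (suc n) h = 0≤+ℚ h (0≤multiple n h)

    -- This is n + 1 ≤ 2^n in disguise: halving a number at most (n + 2) ε leaves one at most (n +
    -- 1) ε, and `halved-½` lets the induction begin by halving w.
    halved≤ : ∀ n {w ε} → 0ℚ ℚ.≤ ε → w ℚ.≤ multiple (suc n) ε → halved n w ℚ.≤ ε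
    halved≤ zero    {w} {ε} hε h = subst (w ℚ.≤_) (ℚ.+-identityʳ ε) h
    halved≤ (suc n) {w} {ε} hε h = subst (ℚ._≤ ε) (sym (halved-½ n w))
      (halved≤ n hε (≤-fromℚ-difference
        (½ ℚ.* (ε ℚ.+ (ε ℚ.+ multiple n ε) ℚ.- w) ℚ.+ ½ ℚ.* multiple n ε)
        (0≤+ℚ (0≤*ℚ (ℚ.<⇒≤ 0<½ℚ) (0≤difference h)) (0≤*ℚ (ℚ.<⇒≤ 0<½ℚ) (0≤multiple n hε)))
        (solve 3 (λ w e m → con ½ :* w :+ (con ½ :* (e :+ (e :+ m) :- w) :+ con ½ :* m) := e :+ m)
          refl w ε (multiple n ε))))

    halving : ∀ w {ε} → 0ℚ ℚ.< ε → ∃[ n ] halved n w ℚ.≤ ε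
    halving w {ε} 0<ε with archimedean w 0<ε
    ... | n , h = n , halved≤ n (ℚ.<⇒≤ 0<ε)
      (ℚ.≤-trans h (≤-fromℚ-difference ε (ℚ.<⇒≤ 0<ε) (ℚ.+-comm (multiple n ε) ε)))

  -- A record, so that the two sides can be inferred, which they cannot be from the
  -- unfolding of _≤_.

  infix 4 _≼_

  record _≼_ (x y : ℝ) : Set where
    constructor wrap
    field unwrap : x ≤ y

  open _≼_ public

  abstract

    ≼-pointwise : ∀ {x y} → (∀ n → seq x n ℚ.≤ seq y n) → x ≼ y
    ≼-pointwise {x} {y} h = wrap λ ε 0<ε → 0 , λ n _ →
      ≤-fromℚ-difference _ (0≤+ℚ (0≤difference (h n)) (ℚ.<⇒≤ 0<ε))
        (solve 3 (λ a b e → a :+ (b :- a :+ e) := b :+ e) refl (seq x n) (seq y n) ε)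

    ≼-reflexive : ∀ {x y} → (∀ n → seq x n ≡ seq y n) → x ≼ y
    ≼-reflexive h = ≼-pointwise λ n → ℚ.≤-reflexive (h n)

    ≼-refl : ∀ {x} → x ≼ x
    ≼-refl = ≼-reflexive λ _ → refl

    ≼-trans : ∀ {x y z} → x ≼ y → y ≼ z → x ≼ z
    ≼-trans {x} {y} {z} (wrap h) (wrap k) = wrap λ ε 0<ε →
      let (M , p) = h (½ ℚ.* ε) (0<½*ℚ 0<ε)
          (N , q) = k (½ ℚ.* ε) (0<½*ℚ 0<ε)
      in M ℕ.⊔ N , λ n l → ≤-fromℚ-difference _
        (0≤+ℚ (0≤difference (p n (ℕ.m⊔n≤o⇒m≤o M N l))) (0≤difference (q n (ℕ.m⊔n≤o⇒n≤o M N l))))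
        (solve 4 (λ a b c e → a :+ ((b :+ con ½ :* e :- a) :+ (c :+ con ½ :* e :- b)) := c :+ e)
          refl (seq x n) (seq y n) (seq z n) ε)

    +-mono-≼ : ∀ {x y u v} → x ≼ y → u ≼ v → x + u ≼ y + v
    +-mono-≼ {x} {y} {u} {v} (wrap h) (wrap k) = wrap λ ε 0<ε →
      let (M , p) = h (½ ℚ.* ε) (0<½*ℚ 0<ε)
          (N , q) = k (½ ℚ.* ε) (0<½*ℚ 0<ε)
      in M ℕ.⊔ N , λ n l → ≤-fromℚ-difference _
        (0≤+ℚ (0≤difference (p n (ℕ.m⊔n≤o⇒m≤o M N l))) (0≤difference (q n (ℕ.m⊔n≤o⇒n≤o M N l))))
        (solve 5 (λ a b c d e → a :+ c :+ ((b :+ con ½ :* e :- a) :+ (d :+ con ½ :* e :- c)) := b :+ d :+ e)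
          refl (seq x n) (seq y n) (seq u n) (seq v n) ε)

    +-monoˡ-≼ : ∀ z {x y} → x ≼ y → x + z ≼ y + z
    +-monoˡ-≼ z h = +-mono-≼ h (≼-refl {z})

    +-monoʳ-≼ : ∀ z {x y} → x ≼ y → z + x ≼ z + y
    +-monoʳ-≼ z h = +-mono-≼ (≼-refl {z}) h

    0≼+ : ∀ {x y} → 0ℝ ≼ x → 0ℝ ≼ y → 0ℝ ≼ x + y
    0≼+ h k = ≼-trans (≼-reflexive λ _ → refl) (+-mono-≼ h k)

    eventually≤ : ∀ x → ∃[ B ] (0ℚ ℚ.< B × ∃[ N ] (∀ n → N ℕ.≤ n → seq x n ℚ.≤ B))
    eventually≤ x with cauchy x 1ℚ 0<1ℚ
    ... | N , h = ℚ.∣ seq x N ∣ ℚ.+ 1ℚ , ℚ.+-mono-≤-< (ℚ.0≤∣p∣ (seq x N)) 0<1ℚ , N , λ n l →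
      ℚ.≤-trans (∣a-b∣≤⇒a≤b+ _ _ (h n N l ℕ.≤-refl)) (ℚ.+-monoˡ-≤ 1ℚ (p≤∣p∣ (seq x N)))

    -- The terms of x and y may be slightly negative. If they are at least -δ and at most A and B,
    -- then x y ≥ -δ y ≥ -δ B when y ≥ 0, and x y ≥ A y ≥ -A δ when y ≤ 0. Hence the choice δ = ε /
    -- (A + B).
    0≼* : ∀ {x y} → 0ℝ ≼ x → 0ℝ ≼ y → 0ℝ ≼ x * y
    0≼* {x} {y} (wrap h) (wrap k) = wrap λ ε 0<ε →
      let (A , 0<A , K , a) = eventually≤ x
          (B , 0<B , L , b) = eventually≤ y
          (d , 0<d , e) = reciprocalℚ (ℚ.+-mono-< 0<A 0<B)
          0<dε = 0<*ℚ 0<d 0<ε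
          (M , p) = h (d ℚ.* ε) 0<dε
          (N , q) = k (d ℚ.* ε) 0<dε
      in (K ℕ.⊔ L) ℕ.⊔ (M ℕ.⊔ N) , λ n l →
        let KL = ℕ.m⊔n≤o⇒m≤o (K ℕ.⊔ L) (M ℕ.⊔ N) l
            MN = ℕ.m⊔n≤o⇒n≤o (K ℕ.⊔ L) (M ℕ.⊔ N) l
        in subst (λ t → 0ℚ ℚ.≤ seq x n ℚ.* seq y n ℚ.+ t)
          (trans (sym (ℚ.*-assoc (A ℚ.+ B) d ε)) (trans (cong (ℚ._* ε) e) (ℚ.*-identityˡ ε)))
          (bound (seq x n) (seq y n) A B (d ℚ.* ε) (ℚ.<⇒≤ 0<A) (ℚ.<⇒≤ 0<B) (ℚ.<⇒≤ 0<dε)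
            (a n (ℕ.m⊔n≤o⇒m≤o K L KL)) (b n (ℕ.m⊔n≤o⇒n≤o K L KL))
            (p n (ℕ.m⊔n≤o⇒m≤o M N MN)) (q n (ℕ.m⊔n≤o⇒n≤o M N MN)))
      where
      bound : ∀ x y A B δ → 0ℚ ℚ.≤ A → 0ℚ ℚ.≤ B → 0ℚ ℚ.≤ δ → x ℚ.≤ A → y ℚ.≤ B →
              0ℚ ℚ.≤ x ℚ.+ δ → 0ℚ ℚ.≤ y ℚ.+ δ → 0ℚ ℚ.≤ x ℚ.* y ℚ.+ (A ℚ.+ B) ℚ.* δ
      bound x y A B δ 0≤A 0≤B 0≤δ x≤A y≤B 0≤x+δ 0≤y+δ with ℚ.≤-total 0ℚ y
      ... | inj₁ 0≤y = subst (0ℚ ℚ.≤_)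
        (solve 5 (λ x y A B d → ((x :+ d) :* y :+ d :* (B :- y)) :+ A :* d := x :* y :+ (A :+ B) :* d)
          refl x y A B δ)
        (0≤+ℚ (0≤+ℚ (0≤*ℚ 0≤x+δ 0≤y) (0≤*ℚ 0≤δ (0≤difference y≤B))) (0≤*ℚ 0≤A 0≤δ))
      ... | inj₂ y≤0 = subst (0ℚ ℚ.≤_)
        (solve 5 (λ x y A B d → ((A :- x) :* (con 0ℚ :- y) :+ A :* (y :+ d)) :+ B :* d := x :* y :+ (A :+ B) :* d)
          refl x y A B δ)
        (0≤+ℚ (0≤+ℚ (0≤*ℚ (0≤difference x≤A) (0≤difference y≤0)) (0≤*ℚ 0≤A 0≤y+δ)) (0≤*ℚ 0≤B 0≤δ))

    ≼-from-difference : ∀ {x y} z → 0ℝ ≼ z → (∀ n → seq x n ℚ.+ seq z n ≡ seq y n) → x ≼ y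
    ≼-from-difference {x} z hz e = ≼-trans (≼-reflexive {x} {x + 0ℝ} λ n → sym (ℚ.+-identityʳ _))
      (≼-trans (+-mono-≼ {x} {x} ≼-refl hz) (≼-reflexive e))

    0≼- : ∀ {x y} → x ≼ y → 0ℝ ≼ y - x
    0≼- {x} {y} h = ≼-trans {y = x - x} (≼-reflexive λ n → sym (ℚ.+-inverseʳ (seq x n)))
      (+-mono-≼ h (≼-refl { - x}))

    *-monoʳ-≼ : ∀ {x y} z → 0ℝ ≼ z → x ≼ y → z * x ≼ z * y
    *-monoʳ-≼ {x} {y} z hz h = ≼-from-difference (z * (y - x)) (0≼* hz (0≼- h)) λ n →
      solve 3 (λ x y z → z :* x :+ z :* (y :- x) := z :* y) refl (seq x n) (seq y n) (seq z n)

    fromℚ-mono : ∀ {a b} → a ℚ.≤ b → fromℚ a ≼ fromℚ b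
    fromℚ-mono h = ≼-pointwise λ _ → h

    0≼fromℚ : ∀ {a} → 0ℚ ℚ.< a → 0ℝ ≼ fromℚ a
    0≼fromℚ h = fromℚ-mono (ℚ.<⇒≤ h)

    0≼1 : 0ℝ ≼ 1ℝ
    0≼1 = 0≼fromℚ 0<1ℚ

    ≼-limit : ∀ {x y} → (∀ ε → 0ℚ ℚ.< ε → x ≼ y + fromℚ ε) → x ≼ y
    ≼-limit {x} {y} h = wrap λ ε 0<ε →
      let (N , p) = unwrap (h (½ ℚ.* ε) (0<½*ℚ 0<ε)) (½ ℚ.* ε) (0<½*ℚ 0<ε)
      in N , λ n l → subst (seq x n ℚ.≤_)
        (solve 2 (λ y e → y :+ con ½ :* e :+ con ½ :* e := y :+ e) refl (seq y n) ε) (p n l)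

    ≼fromℚ : ∀ x → ∃[ B ] (0ℚ ℚ.< B × x ≼ fromℚ B)
    ≼fromℚ x = let (B , 0<B , N , h) = eventually≤ x in B , 0<B , wrap λ ε 0<ε → N , λ n l →
      ≤-fromℚ-difference _ (0≤+ℚ (0≤difference (h n l)) (ℚ.<⇒≤ 0<ε))
        (solve 3 (λ x b e → x :+ (b :- x :+ e) := b :+ e) refl (seq x n) B ε)

    +fromℚ⋠ : ∀ {x ε} → 0ℚ ℚ.< ε → ¬ (x + fromℚ ε ≼ x)
    +fromℚ⋠ {x} {ε} 0<ε (wrap h) with h (½ ℚ.* ε) (0<½*ℚ 0<ε)
    ... | N , p = ℚ.<-irrefl refl (ℚ.<-≤-trans (0<½*ℚ 0<ε) (≤-fromℚ-difference _ (0≤difference (p N ℕ.≤-refl))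
      (solve 2 (λ x e → con ½ :* e :+ (x :+ con ½ :* e :- (x :+ e)) := con 0ℚ) refl (seq x N) ε)))

    <⇒+fromℚ≼ : ∀ {x y} → x < y → ∃[ ε ] (0ℚ ℚ.< ε × x + fromℚ ε ≼ y)
    <⇒+fromℚ≼ {x} {y} (ε , 0<ε , N , h) = ε , 0<ε , wrap λ δ 0<δ → N , λ n l →
      ≤-fromℚ-difference _ (0≤+ℚ (0≤difference (h n l)) (ℚ.<⇒≤ 0<δ))
        (solve 4 (λ x e y d → x :+ e :+ (y :- (x :+ e) :+ d) := y :+ d) refl (seq x n) ε (seq y n) δ)

    ≼-⊓ : ∀ {x y} → x ≼ y → x ≼ x ⊓ y
    ≼-⊓ {x} {y} (wrap h) = wrap λ ε 0<ε → let (N , p) = h ε 0<ε in N , λ n l →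
      case ℚ.⊓-sel (seq x n) (seq y n) of λ
        { (inj₁ e) → subst (λ t → seq x n ℚ.≤ t ℚ.+ ε) (sym e)
            (≤-fromℚ-difference ε (ℚ.<⇒≤ 0<ε) refl)
        ; (inj₂ e) → subst (λ t → seq x n ℚ.≤ t ℚ.+ ε) (sym e) (p n l) }

    ⊓≼ˡ : ∀ {x y} → x ⊓ y ≼ x
    ⊓≼ˡ {x} {y} = ≼-pointwise λ n → ℚ.p⊓q≤p (seq x n) (seq y n)

    ≼-⊓′ : ∀ {x y} → y ≼ x → y ≼ x ⊓ y
    ≼-⊓′ {x} {y} h = ≼-trans (≼-⊓ h) (≼-reflexive λ n → ℚ.⊓-comm (seq y n) (seq x n))

    ⊓≼ʳ : ∀ {x y} → x ⊓ y ≼ y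
    ⊓≼ʳ {x} {y} = ≼-pointwise λ n → ℚ.p⊓q≤q (seq x n) (seq y n)

  -- Classical order of the reals: strict gaps, totality, bisection and reciprocals.

  module Order (em : ∀ ℓ → ExcludedMiddle ℓ) where

    stable : ∀ {ℓ} {P : Set ℓ} → ¬ ¬ P → P
    stable {ℓ} = decidable-stable (em ℓ)

    ¬∀⇒∃¬ : ∀ {a b} {A : Set a} {P : A → Set b} → ¬ (∀ x → P x) → ∃[ x ] ¬ P x
    ¬∀⇒∃¬ h = stable λ k → h λ x → stable λ q → k (x , q)

    ¬→⇒×¬ : ∀ {a b} {A : Set a} {B : Set b} → ¬ (A → B) → A × ¬ B
    ¬→⇒×¬ h = stable (λ k → h λ x → ⊥-elim (k x)) , λ b → h λ _ → b

    abstract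

      -- With δ = ε / 8, both sequences vary by at most δ from some index K on, so one comparison of
      -- x with y + 3 δ at K decides: if x is below, then x ≤ y + 8 δ, against the choice of ε;
      -- otherwise a gap of δ persists.
      ⋠⇒+fromℚ≼ : ∀ {x y} → ¬ (x ≼ y) → ∃[ ε ] (0ℚ ℚ.< ε × y + fromℚ ε ≼ x)
      ⋠⇒+fromℚ≼ {x} {y} h =
        let (ε , k) = ¬∀⇒∃¬ (λ k → h (≼-limit λ ε → k ε))
            (0<ε , x⋠y+ε) = ¬→⇒×¬ k
            δ = ½ ℚ.* (½ ℚ.* (½ ℚ.* ε))
            0<δ = 0<½*ℚ (0<½*ℚ (0<½*ℚ 0<ε))
            (M , p) = cauchy x δ 0<δ
            (N , q) = cauchy y δ 0<δ
        in δ , 0<δ , separate δ 0<δ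
             (x⋠y+ε ∘ subst (λ t → x ≼ y + fromℚ t)
               (trans (cong (λ t → (t ℚ.+ t) ℚ.+ (t ℚ.+ t)) (½+½ (½ ℚ.* (½ ℚ.* ε))))
                 (trans (cong (λ t → t ℚ.+ t) (½+½ (½ ℚ.* ε))) (½+½ ε))))
             (M ℕ.⊔ N)
             (λ m n lm ln → p m n (ℕ.m⊔n≤o⇒m≤o M N lm) (ℕ.m⊔n≤o⇒m≤o M N ln))
             (λ m n lm ln → q m n (ℕ.m⊔n≤o⇒n≤o M N lm) (ℕ.m⊔n≤o⇒n≤o M N ln))
        where
        separate : ∀ δ → 0ℚ ℚ.< δ → ¬ (x ≼ y + fromℚ (((δ ℚ.+ δ) ℚ.+ (δ ℚ.+ δ)) ℚ.+ ((δ ℚ.+ δ) ℚ.+ (δ ℚ.+ δ)))) → ∀ K →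
          (∀ m n → K ℕ.≤ m → K ℕ.≤ n → ℚ.∣ seq x m ℚ.- seq x n ∣ ℚ.≤ δ) →
          (∀ m n → K ℕ.≤ m → K ℕ.≤ n → ℚ.∣ seq y m ℚ.- seq y n ∣ ℚ.≤ δ) →
          y + fromℚ δ ≼ x
        separate δ 0<δ x⋠y+4δ K p q = [ (λ l → ⊥-elim (x⋠y+4δ (close l))) , far ]′
          (ℚ.≤-total (seq x K) (seq y K ℚ.+ ((δ ℚ.+ δ) ℚ.+ δ)))
          where
          close : seq x K ℚ.≤ seq y K ℚ.+ ((δ ℚ.+ δ) ℚ.+ δ) → x ≼ y + fromℚ (((δ ℚ.+ δ) ℚ.+ (δ ℚ.+ δ)) ℚ.+ ((δ ℚ.+ δ) ℚ.+ (δ ℚ.+ δ)))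
          close l = wrap λ η 0<η → K , λ n K≤n → ≤-fromℚ-difference _
            (0≤+ℚ (0≤+ℚ (0≤+ℚ (0≤difference l)
                (0≤difference (∣a-b∣≤⇒a≤b+ (seq x n) (seq x K) (p n K K≤n ℕ.≤-refl))))
                (0≤difference (∣a-b∣≤⇒a≤b+ (seq y K) (seq y n) (q K n ℕ.≤-refl K≤n))))
              (ℚ.<⇒≤ (ℚ.+-mono-< (ℚ.+-mono-< (ℚ.+-mono-< 0<δ 0<δ) 0<δ) 0<η)))
            (solve 6 (λ xn xK yn yK d e → xn :+ (((yK :+ ((d :+ d) :+ d) :- xK) :+ (xK :+ d :- xn)
                :+ (yn :+ d :- yK)) :+ (((d :+ d) :+ d) :+ e))
                := yn :+ (((d :+ d) :+ (d :+ d)) :+ ((d :+ d) :+ (d :+ d))) :+ e)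
              refl (seq x n) (seq x K) (seq y n) (seq y K) δ η)

          far : seq y K ℚ.+ ((δ ℚ.+ δ) ℚ.+ δ) ℚ.≤ seq x K → y + fromℚ δ ≼ x
          far l = wrap λ η 0<η → K , λ n K≤n → ≤-fromℚ-difference _
            (0≤+ℚ (0≤+ℚ (0≤+ℚ (0≤difference l) (ℚ.<⇒≤ 0<η))
                (0≤difference (∣a-b∣≤⇒a≤b+ (seq x K) (seq x n) (p K n ℕ.≤-refl K≤n))))
                (0≤difference (∣a-b∣≤⇒a≤b+ (seq y n) (seq y K) (q n K K≤n ℕ.≤-refl))))
            (solve 6 (λ xn xK yn yK d e → yn :+ d :+ (((xK :- (yK :+ ((d :+ d) :+ d))) :+ e)
                :+ (xn :+ d :- xK) :+ (yK :+ d :- yn)) := xn :+ e)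
              refl (seq x n) (seq x K) (seq y n) (seq y K) δ η)

      ≼-total : ∀ x y → x ≼ y ⊎ y ≼ x
      ≼-total x y = case em 0ℓ {x ≼ y} of λ
        { (yes h) → inj₁ h
        ; (no h)  → let (ε , 0<ε , k) = ⋠⇒+fromℚ≼ h in
            inj₂ (≼-trans (≼-from-difference (fromℚ ε) (0≼fromℚ 0<ε) λ _ → refl) k) }

      -- Bisection, with `Q` false at the left end and true at the right end. The limit supplies the
      -- completeness of the reals: it yields sums, outer measures and reciprocals.
      module Cut (Q : ℚ → Set) (l₀ u₀ : ℚ) (l₀≤u₀ : l₀ ℚ.≤ u₀) (¬Ql₀ : ¬ Q l₀) (Qu₀ : Q u₀) where

        record Interval : Set where
          field
            l u : ℚ
            ¬Ql : ¬ Q l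
            Qu  : Q u
            l≤u : l ℚ.≤ u
        open Interval

        l≤mid : ∀ {a b} → a ℚ.≤ b → a ℚ.≤ ½ ℚ.* (a ℚ.+ b)
        l≤mid {a} {b} h = ≤-fromℚ-difference _ (0≤*ℚ (ℚ.<⇒≤ 0<½ℚ) (0≤difference h))
          (solve 2 (λ a b → a :+ con ½ :* (b :- a) := con ½ :* (a :+ b)) refl a b)

        mid≤u : ∀ {a b} → a ℚ.≤ b → ½ ℚ.* (a ℚ.+ b) ℚ.≤ b
        mid≤u {a} {b} h = ≤-fromℚ-difference _ (0≤*ℚ (ℚ.<⇒≤ 0<½ℚ) (0≤difference h))
          (solve 2 (λ a b → con ½ :* (a :+ b) :+ con ½ :* (b :- a) := b) refl a b)

        halve : (i : Interval) → Σ[ j ∈ Interval ]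
          (l i ℚ.≤ l j × u j ℚ.≤ u i × u j ℚ.- l j ≡ ½ ℚ.* (u i ℚ.- l i))
        halve i with em 0ℓ {Q (½ ℚ.* (l i ℚ.+ u i))}
        ... | yes q = record { ¬Ql = ¬Ql i ; Qu = q ; l≤u = l≤mid (l≤u i) }
          , ℚ.≤-refl , mid≤u (l≤u i)
          , solve 2 (λ a b → con ½ :* (a :+ b) :- a := con ½ :* (b :- a)) refl (l i) (u i)
        ... | no ¬q = record { ¬Ql = ¬q ; Qu = Qu i ; l≤u = mid≤u (l≤u i) }
          , l≤mid (l≤u i) , ℚ.≤-refl
          , solve 2 (λ a b → b :- con ½ :* (a :+ b) := con ½ :* (b :- a)) refl (l i) (u i)

        interval : ℕ → Interval
        interval zero    = record { l = l₀ ; u = u₀ ; ¬Ql = ¬Ql₀ ; Qu = Qu₀ ; l≤u = l₀≤u₀ }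
        interval (suc n) = proj₁ (halve (interval n))

        lower upper : ℕ → ℚ
        lower n = l (interval n)
        upper n = u (interval n)

        width : ∀ n → upper n ℚ.- lower n ≡ halved n (u₀ ℚ.- l₀)
        width zero    = halved-zero (u₀ ℚ.- l₀)
        width (suc n) = trans (proj₂ (proj₂ (proj₂ (halve (interval n)))))
          (trans (cong (½ ℚ.*_) (width n)) (halved-suc n (u₀ ℚ.- l₀)))

        upper-antitone : ∀ {m n} → m ℕ.≤′ n → upper n ℚ.≤ upper m
        upper-antitone ℕ.≤′-refl = ℚ.≤-refl
        upper-antitone {n = suc n} (ℕ.≤′-step h) =
          ℚ.≤-trans (proj₁ (proj₂ (proj₂ (halve (interval n))))) (upper-antitone h)

        lower-monotone : ∀ {m n} → m ℕ.≤′ n → lower m ℚ.≤ lower n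
        lower-monotone ℕ.≤′-refl = ℚ.≤-refl
        lower-monotone {n = suc n} (ℕ.≤′-step h) =
          ℚ.≤-trans (lower-monotone h) (proj₁ (proj₂ (halve (interval n))))

        -- The intervals of index at least N are contained in the N-th one, and
        -- that one has length at most ε.
        upper-near : ∀ {N ε} → upper N ℚ.- lower N ℚ.≤ ε →
                     ∀ {n} → N ℕ.≤ n → upper N ℚ.≤ upper n ℚ.+ ε
        upper-near {N} {ε} w {n} N≤n = ≤-fromℚ-difference _
          (0≤+ℚ (0≤difference w)
            (0≤difference (ℚ.≤-trans (lower-monotone (ℕ.≤⇒≤′ N≤n)) (l≤u (interval n)))))
          (solve 4 (λ uN lN un e → uN :+ ((e :- (uN :- lN)) :+ (un :- lN)) := un :+ e)
            refl (upper N) (lower N) (upper n) ε)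

        small : ∀ ε → 0ℚ ℚ.< ε → ∃[ N ] upper N ℚ.- lower N ℚ.≤ ε
        small ε 0<ε = let (N , h) = halving (u₀ ℚ.- l₀) 0<ε in N , subst (ℚ._≤ ε) (sym (width N)) h

        cut : ℝ
        cut = mkℝ upper λ ε 0<ε → let (N , w) = small ε 0<ε in N , λ m n N≤m N≤n →
          a≤b+⇒∣a-b∣≤ (upper m) (upper n)
            (ℚ.≤-trans (upper-antitone (ℕ.≤⇒≤′ N≤m)) (upper-near w N≤n))
            (ℚ.≤-trans (upper-antitone (ℕ.≤⇒≤′ N≤n)) (upper-near w N≤m))

        above-cut : ∀ ε → 0ℚ ℚ.< ε → ∃[ q ] (Q q × fromℚ q ≼ cut + fromℚ ε)
        above-cut ε 0<ε = let (N , w) = small ε 0<ε in upper N , Qu (interval N) , wrap λ δ 0<δ →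
          N , λ n N≤n → ≤-fromℚ-difference _ (0≤+ℚ (0≤difference (upper-near w N≤n)) (ℚ.<⇒≤ 0<δ))
            (solve 4 (λ uN un e d → uN :+ (un :+ e :- uN :+ d) := un :+ e :+ d)
              refl (upper N) (upper n) ε δ)

        below-cut : ∀ ε → 0ℚ ℚ.< ε → ∃[ q ] (¬ Q q × cut ≼ fromℚ q + fromℚ ε)
        below-cut ε 0<ε = let (N , w) = small ε 0<ε in lower N , ¬Ql (interval N) , wrap λ δ 0<δ →
          N , λ n N≤n → ≤-fromℚ-difference _
            (0≤+ℚ (0≤+ℚ (0≤difference w) (0≤difference (upper-antitone (ℕ.≤⇒≤′ N≤n)))) (ℚ.<⇒≤ 0<δ))
            (solve 5 (λ uN lN un e d → un :+ ((e :- (uN :- lN)) :+ (uN :- un) :+ d) := lN :+ e :+ d)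
              refl (upper N) (lower N) (upper n) ε δ)

    exists-cut : (Q : ℚ → Set) (l u : ℚ) → l ℚ.≤ u → ¬ Q l → Q u → ∃[ x ]
      ((∀ ε → 0ℚ ℚ.< ε → ∃[ q ] (Q q × fromℚ q ≼ x + fromℚ ε)) ×
       (∀ ε → 0ℚ ℚ.< ε → ∃[ q ] (¬ Q q × x ≼ fromℚ q + fromℚ ε)))
    exists-cut Q l u l≤u ¬Ql Qu = Cut.cut Q l u l≤u ¬Ql Qu
      , Cut.above-cut Q l u l≤u ¬Ql Qu , Cut.below-cut Q l u l≤u ¬Ql Qu

    abstract

      -- The reciprocal is the cut between the rationals q with x q < 1 and those with 1 ≤ x q,
      -- found between 0 and 1 / ε.
      exists-inverse : ∀ x {ε} → 0ℚ ℚ.< ε → fromℚ ε ≼ x →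
        ∃[ y ] (0ℝ ≼ y × x * y ≼ 1ℝ × 1ℝ ≼ x * y)
      exists-inverse x {ε} 0<ε ε≼x =
        let (d , 0<d , εd≡1) = reciprocalℚ 0<ε
            (y , above , below) = exists-cut (λ q → 1ℝ ≼ x * fromℚ q) 0ℚ d (ℚ.<⇒≤ 0<d)
              (λ h → +fromℚ⋠ {0ℝ} 0<1ℚ (≼-trans {y = 1ℝ} (≼-reflexive λ _ → refl)
                (≼-trans h (≼-reflexive λ n → ℚ.*-zeroʳ (seq x n)))))
              (≼-trans {y = fromℚ d * fromℚ ε} (≼-reflexive λ _ → sym (trans (ℚ.*-comm d ε) εd≡1))
                (≼-trans (*-monoʳ-≼ (fromℚ d) (0≼fromℚ 0<d) ε≼x)
                  (≼-reflexive λ n → ℚ.*-comm d (seq x n))))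
            -- With b = 1 / B, an error of b η in y changes x y by at most η.
            (B , 0<B , x≼B) = ≼fromℚ x
            (b , 0<b , Bb≡1) = reciprocalℚ 0<B
            error : ∀ η → 0ℚ ℚ.< η → x * fromℚ (b ℚ.* η) ≼ fromℚ η
            error η 0<η = ≼-trans {y = fromℚ (b ℚ.* η) * x} (≼-reflexive λ n → ℚ.*-comm (seq x n) _)
              (≼-trans (*-monoʳ-≼ (fromℚ (b ℚ.* η)) (0≼fromℚ (0<*ℚ 0<b 0<η)) x≼B)
                (≼-reflexive λ _ → trans (ℚ.*-comm (b ℚ.* η) B)
                  (trans (sym (ℚ.*-assoc B b η)) (trans (cong (ℚ._* η) Bb≡1) (ℚ.*-identityˡ η)))))
            0≼x = ≼-trans (0≼fromℚ 0<ε) ε≼x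
        in y
         , ≼-limit (λ η 0<η → let (q , 1≼xq , q≼y+η) = above η 0<η in
             ≼-trans {y = fromℚ q} ([ (λ h → h) , (λ q≼0 → ⊥-elim (+fromℚ⋠ {0ℝ} 0<1ℚ
               (≼-trans {y = 1ℝ} (≼-reflexive λ _ → refl) (≼-trans 1≼xq
                 (≼-trans (*-monoʳ-≼ x 0≼x q≼0) (≼-reflexive λ n → ℚ.*-zeroʳ (seq x n))))))) ]′
               (≼-total 0ℝ (fromℚ q))) q≼y+η)
         , ≼-limit (λ η 0<η → let (q , 1⋠xq , y≼q+η) = below (b ℚ.* η) (0<*ℚ 0<b 0<η) in
             ≼-trans (*-monoʳ-≼ x 0≼x y≼q+η) (≼-trans {y = x * fromℚ q + x * fromℚ (b ℚ.* η)}
               (≼-reflexive λ n → ℚ.*-distribˡ-+ (seq x n) q (b ℚ.* η))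
               (+-mono-≼ ([ (λ h → h) , (λ h → ⊥-elim (1⋠xq h)) ]′ (≼-total (x * fromℚ q) 1ℝ)) (error η 0<η))))
         , ≼-limit (λ η 0<η → let (q , 1≼xq , q≼y+η) = above (b ℚ.* η) (0<*ℚ 0<b 0<η) in
             ≼-trans 1≼xq (≼-trans (*-monoʳ-≼ x 0≼x q≼y+η) (≼-trans {y = x * y + x * fromℚ (b ℚ.* η)}
               (≼-reflexive λ n → ℚ.*-distribˡ-+ (seq x n) (seq y n) (b ℚ.* η))
               (+-mono-≼ ≼-refl (error η 0<η)))))

open Reals

-- Covers by cylinders and null sets.

module Covering where

  mass : (ℕ → ℝ) → Maybe (List Bool) → ℝ
  mass s = maybe′ (cylinderMeasure s) 0ℝ

  total : (ℕ → ℝ) → (ℕ → Maybe (List Bool)) → ℕ → ℝ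
  total s c = partialSum (mass s ∘ c)

  -- All partial sums are bounded by v, in place of a sum equal to v as in `IsOuterMeasure`, so that
  -- no limit has to be formed. `covered⇒sum` recovers the sum.
  record Covered (s : ℕ → ℝ) (A : Pred Cantor 0ℓ) (v : ℝ) : Set where
    constructor covering
    field
      cover  : ℕ → Maybe (List Bool)
      covers : Covers cover A
      bound  : ∀ m → total s cover m ≼ v

  Null : (ℕ → ℝ) → Pred Cantor 0ℓ → Set
  Null s A = ∀ ε → 0ℚ ℚ.< ε → Covered s A (fromℚ ε)

  IsProbability : ℝ → Set
  IsProbability p = 0ℝ ≼ p × p ≼ 1ℝ

  AreProbabilities : (ℕ → ℝ) → Set
  AreProbabilities s = ∀ n → IsProbability (s n)

  bias : ℝ → Bool → ℝ
  bias p b = if b then p else 1ℝ - p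

  trivialCover : ℕ → Maybe (List Bool)
  trivialCover zero    = just []
  trivialCover (suc _) = nothing

  interleave : ∀ {A : Set} → (ℕ → A) → (ℕ → A) → ℕ → A
  interleave f g zero    = f 0
  interleave f g (suc n) = interleave g (f ∘ suc) n

  abstract

    bias-nonneg : ∀ {p} → IsProbability p → ∀ b → 0ℝ ≼ bias p b
    bias-nonneg (0≼p , p≼1) true  = 0≼p
    bias-nonneg (0≼p , p≼1) false = 0≼- p≼1

    cylinderMeasure-nonneg : ∀ {s} → AreProbabilities s → ∀ σ → 0ℝ ≼ cylinderMeasure s σ
    cylinderMeasure-nonneg h []      = 0≼1
    cylinderMeasure-nonneg h (b ∷ σ) = 0≼* (bias-nonneg (h 0) b) (cylinderMeasure-nonneg (h ∘ suc) σ)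

    mass-nonneg : ∀ {s} → AreProbabilities s → ∀ i → 0ℝ ≼ mass s i
    mass-nonneg h (just σ) = cylinderMeasure-nonneg h σ
    mass-nonneg h nothing  = ≼-refl

    partialSum-mono : ∀ {f g} → (∀ i → f i ≼ g i) → ∀ m → partialSum f m ≼ partialSum g m
    partialSum-mono h zero    = ≼-refl
    partialSum-mono h (suc m) = +-mono-≼ (partialSum-mono h m) (h m)

    ≼+ʳ : ∀ {x y} → 0ℝ ≼ y → x ≼ x + y
    ≼+ʳ {x} {y} h = ≼-from-difference y h λ _ → refl

    partialSum-monotone : ∀ {f} → (∀ i → 0ℝ ≼ f i) → ∀ {m n} → m ℕ.≤ n →
                          partialSum f m ≼ partialSum f n
    partialSum-monotone {f} h l = go (ℕ.≤⇒≤′ l)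
      where
      go : ∀ {m n} → m ℕ.≤′ n → partialSum f m ≼ partialSum f n
      go ℕ.≤′-refl             = ≼-refl
      go {m} {suc n} (ℕ.≤′-step l) = ≼-trans (go l) (≼+ʳ (h n))

    partialSum-nonneg : ∀ {f} → (∀ i → 0ℝ ≼ f i) → ∀ m → 0ℝ ≼ partialSum f m
    partialSum-nonneg h m = partialSum-monotone h {0} ℕ.z≤n

    partialSum-combination : ∀ {f g h} α β → (∀ i → α * f i + β * g i ≼ h i) →
      ∀ m → α * partialSum f m + β * partialSum g m ≼ partialSum h m
    partialSum-combination α β k zero = ≼-reflexive λ n →
      solve 2 (λ a b → a :* con 0ℚ :+ b :* con 0ℚ := con 0ℚ) refl (seq α n) (seq β n)
    partialSum-combination {f} {g} {h} α β k (suc m) = ≼-trans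
      {y = (α * partialSum f m + β * partialSum g m) + (α * f m + β * g m)}
      (≼-reflexive λ n → solve 6 (λ a b F f G g → a :* (F :+ f) :+ b :* (G :+ g) := (a :* F :+ b :* G) :+ (a :* f :+ b :* g))
        refl (seq α n) (seq β n) (seq (partialSum f m) n) (seq (f m) n) (seq (partialSum g m) n) (seq (g m) n))
      (+-mono-≼ (partialSum-combination α β k m) (k m))

    partialSum-head : ∀ f m → partialSum f (suc m) ≼ f 0 + partialSum (f ∘ suc) m
    partialSum-head f zero    = ≼-reflexive λ n → ℚ.+-comm 0ℚ (seq (f 0) n)
    partialSum-head f (suc m) = ≼-trans (+-monoˡ-≼ (f (suc m)) (partialSum-head f m))
      (≼-reflexive λ n → ℚ.+-assoc (seq (f 0) n) (seq (partialSum (f ∘ suc) m) n) (seq (f (suc m)) n))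

    partialSum-head⁻¹ : ∀ f m → f 0 + partialSum (f ∘ suc) m ≼ partialSum f (suc m)
    partialSum-head⁻¹ f zero    = ≼-reflexive λ n → ℚ.+-comm (seq (f 0) n) 0ℚ
    partialSum-head⁻¹ f (suc m) = ≼-trans
      (≼-reflexive λ n → sym (ℚ.+-assoc (seq (f 0) n) (seq (partialSum (f ∘ suc) m) n) (seq (f (suc m)) n)))
      (+-monoˡ-≼ (f (suc m)) (partialSum-head⁻¹ f m))

    -- The numbers j and k of terms taken from f and g are left existential, which suffices because
    -- covers bound all their partial sums at once.
    partialSum-interleave : ∀ {A : Set} (μ : A → ℝ) f g m → ∃[ j ] ∃[ k ]
      partialSum (μ ∘ interleave f g) m ≼ partialSum (μ ∘ f) j + partialSum (μ ∘ g) k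
    partialSum-interleave μ f g zero    = 0 , 0 , ≼-reflexive λ _ → refl
    partialSum-interleave μ f g (suc m) =
      let (j , k , h) = partialSum-interleave μ g (f ∘ suc) m
          G = partialSum (μ ∘ g) j
          F = partialSum (μ ∘ f ∘ suc) k
      in suc k , j , ≼-trans (partialSum-head (μ ∘ interleave f g) m)
        (≼-trans (+-monoʳ-≼ (μ (f 0)) h)
          (≼-trans {y = (μ (f 0) + F) + G}
            (≼-reflexive λ n → solve 3 (λ a b c → a :+ (b :+ c) := (a :+ c) :+ b) refl
              (seq (μ (f 0)) n) (seq G n) (seq F n))
            (+-monoˡ-≼ G (partialSum-head⁻¹ (μ ∘ f) k))))

    mutual
      interleave-left : ∀ {A : Set} (f g : ℕ → A) n → ∃[ k ] interleave f g k ≡ f n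
      interleave-left f g zero    = 0 , refl
      interleave-left f g (suc n) = let (k , e) = interleave-right g (f ∘ suc) n in suc k , e

      interleave-right : ∀ {A : Set} (f g : ℕ → A) n → ∃[ k ] interleave f g k ≡ g n
      interleave-right f g n = let (k , e) = interleave-left g (f ∘ suc) n in suc k , e

    total-trivialCover : ∀ s m → total s trivialCover m ≼ 1ℝ
    total-trivialCover s zero          = 0≼1
    total-trivialCover s (suc zero)    = ≼-reflexive λ _ → refl
    total-trivialCover s (suc (suc m)) = ≼-trans
      (≼-reflexive λ n → ℚ.+-identityʳ (seq (total s trivialCover (suc m)) n)) (total-trivialCover s (suc m))

    covered-by-whole : ∀ s A → Covered s A 1ℝ
    covered-by-whole s A = covering trivialCover (λ _ _ → 0 , tt) (total-trivialCover s)

    covered-⊆ : ∀ {s A B v} → (∀ x → A x → B x) → Covered s B v → Covered s A v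
    covered-⊆ A⊆B (covering c h k) = covering c (λ x → h x ∘ A⊆B x) k

    covered-≼ : ∀ {s A u v} → u ≼ v → Covered s A u → Covered s A v
    covered-≼ u≼v (covering c h k) = covering c h λ m → ≼-trans (k m) u≼v

    covered-nonneg : ∀ {s A v} → Covered s A v → 0ℝ ≼ v
    covered-nonneg (covering c _ k) = k 0

    covered-∪ : ∀ {s A B C u v} → (∀ x → C x → A x ⊎ B x) →
                Covered s A u → Covered s B v → Covered s C (u + v)
    covered-∪ {s} {C = C} {u} {v} split (covering c hc kc) (covering d hd kd) = covering (interleave c d) covers λ m →
        let (j , k , h) = partialSum-interleave (mass s) c d m in ≼-trans h (+-mono-≼ {y = u} {v = v} (kc j) (kd k))
      where
      covers : Covers (interleave c d) C
      covers x Cx = case split x Cx of λ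
        { (inj₁ Ax) → let (n , e) = hc x Ax ; (k , i) = interleave-left c d n in
            k , subst (maybe′ (x Extends_) ⊥) (sym i) e
        ; (inj₂ Bx) → let (n , e) = hd x Bx ; (k , i) = interleave-right c d n in
            k , subst (maybe′ (x Extends_) ⊥) (sym i) e }

    HasSum-upper : ∀ {f w} → HasSum f w → ∀ m → partialSum f m ≼ w
    HasSum-upper {f} (h , _) m = wrap (h (partialSum f m) (m , unwrap (≼-refl {partialSum f m}) , unwrap (≼-refl {partialSum f m})))

    HasSum-least : ∀ {f w} → HasSum f w → ∀ {u} → (∀ m → partialSum f m ≼ u) → w ≼ u
    HasSum-least {f} (_ , h) {u} k = wrap (h u λ { w (m , w≤ , _) → unwrap (≼-trans {w} {partialSum f m} (wrap w≤) (k m)) })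

    -- The bisections for sums and outer measures start at -1, since at 0 their predicate may hold
    -- already.
    0≼negative : ¬ (0ℝ ≼ fromℚ (ℚ.- 1ℚ))
    0≼negative h = +fromℚ⋠ {fromℚ (ℚ.- 1ℚ)} 0<1ℚ (≼-trans (≼-reflexive λ _ → refl) h)

    negative≤ : ∀ {q} → 0ℚ ℚ.< q → ℚ.- 1ℚ ℚ.≤ q
    negative≤ h = ℚ.≤-trans (ℚ.<⇒≤ (ℚ.negative⁻¹ (ℚ.- 1ℚ))) (ℚ.<⇒≤ h)

  -- Existence of outer measures, Carathéodory measurability and null sets.

  module OuterMeasure (em : ∀ ℓ → ExcludedMiddle ℓ) where

    open Order em

    abstract

      -- The sum is the cut at the rational upper bounds of the partial sums.
      bounded⇒HasSum : ∀ f V → (∀ m → partialSum f m ≼ V) → ∃[ w ] HasSum f w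
      bounded⇒HasSum f V h =
        let (B , 0<B , V≼B) = ≼fromℚ V
            (w , above , below) = exists-cut (λ q → ∀ m → partialSum f m ≼ fromℚ q) (ℚ.- 1ℚ) B (negative≤ 0<B)
              (λ k → 0≼negative (k 0)) (λ m → ≼-trans (h m) V≼B)
        in w
         , (λ { u (m , u≤ , _) → unwrap (≼-limit {u} {w} λ ε 0<ε → let (q , k , q≼) = above ε 0<ε in
               ≼-trans (≼-trans (wrap u≤) (k m)) q≼) })
         , λ u k → unwrap (≼-limit {w} {u} λ ε 0<ε → let (q , ¬k , ≼q) = below ε 0<ε in
             ≼-trans ≼q (+-monoˡ-≼ (fromℚ ε) ([ (λ l → l) , (λ u≼q → ⊥-elim (¬k λ m → ≼-trans
               (wrap (k (partialSum f m) (m , unwrap (≼-refl {partialSum f m}) , unwrap (≼-refl {partialSum f m})))) u≼q)) ]′ (≼-total (fromℚ q) u))))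

      covered⇒sum : ∀ {s A v} → Covered s A v →
        ∃[ w ] (w ≼ v × ∃[ c ] (Covers c A × HasSum (mass s ∘ c) w))
      covered⇒sum {s} {v = v} (covering c h k) = let (w , p) = bounded⇒HasSum (mass s ∘ c) v k in
        w , HasSum-least p k , c , h , p

      outer≼ : ∀ {s A a v} → IsOuterMeasure s A a → Covered s A v → a ≼ v
      outer≼ (lower , _) cov = let (w , w≼v , m) = covered⇒sum cov in ≼-trans (wrap (lower w m)) w≼v

      -- Otherwise a + ε would be a lower bound for the sums of all covers, while a is the greatest
      -- one.
      outer-approximation : ∀ {s A a} → IsOuterMeasure s A a →
        ∀ ε → 0ℚ ℚ.< ε → Covered s A (a + fromℚ ε)
      outer-approximation {s} {A} {a} (_ , greatest) ε 0<ε = stable λ ¬cov →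
        +fromℚ⋠ {a} 0<ε (wrap (greatest (a + fromℚ ε) λ { v (c , h , p) → unwrap
          ([ (λ l → l) , (λ v≼ → ⊥-elim (¬cov (covering c h λ m → ≼-trans (HasSum-upper p m) v≼))) ]′
            (≼-total (a + fromℚ ε) v)) }))

      isOuterMeasure : ∀ {s A a} → (∀ {v} → Covered s A v → a ≼ v) →
        (∀ ε → 0ℚ ℚ.< ε → ∃[ v ] (Covered s A v × v ≼ a + fromℚ ε)) → IsOuterMeasure s A a
      isOuterMeasure {s} {a = a} lower approx =
        (λ { v (c , h , p) → unwrap {a} {v} (lower (covering c h (HasSum-upper {mass s ∘ c} p))) })
        , λ u k → unwrap (≼-limit {u} λ ε 0<ε →
            let (v , cov , v≼) = approx ε 0<ε
                (w , w≼v , m) = covered⇒sum cov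
            in ≼-trans (wrap (k w m)) (≼-trans w≼v v≼))

      exists-outerMeasure : ∀ s A → ∃[ a ] IsOuterMeasure s A a
      exists-outerMeasure s A =
        let (a , above , below) = exists-cut (λ q → Covered s A (fromℚ q)) (ℚ.- 1ℚ) 1ℚ (negative≤ 0<1ℚ)
              (λ cov → 0≼negative (covered-nonneg cov)) (covered-by-whole s A)
        in a , isOuterMeasure
          (λ {v} cov → ≼-limit λ ε 0<ε → let (q , ¬cov , ≼q) = below ε 0<ε in
            ≼-trans ≼q (+-monoˡ-≼ (fromℚ ε) ([ (λ l → l) , (λ v≼q → ⊥-elim (¬cov (covered-≼ v≼q cov))) ]′
              (≼-total (fromℚ q) v))))
          (λ ε 0<ε → let (q , cov , q≼) = above ε 0<ε in fromℚ q , cov , q≼)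

      -- Monotonicity gives b = 0 and c ≤ a, and joining covers of the two parts gives a ≤ b + c.
      null⇒measurable : ∀ {s A} → Null s A → Measurable s A
      null⇒measurable {s} {A} null E a b c ha hb hc = unwrap a≼b+c , unwrap b+c≼a
        where
        a≼b+c : a ≼ b + c
        a≼b+c = ≼-limit λ ε 0<ε → ≼-trans
          (outer≼ ha (covered-∪ {A = E ∩ A} {B = E ∩ ∁ A} {C = E} (λ x Ex → case em 0ℓ {A x} of λ
              { (yes Ax) → inj₁ (Ex , Ax) ; (no ¬Ax) → inj₂ (Ex , ¬Ax) })
            (outer-approximation {a = b} hb (½ ℚ.* ε) (0<½*ℚ 0<ε)) (outer-approximation {a = c} hc (½ ℚ.* ε) (0<½*ℚ 0<ε))))
          (≼-reflexive λ n → trans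
            (solve 3 (λ b c e → (b :+ e) :+ (c :+ e) := (b :+ c) :+ (e :+ e)) refl (seq b n) (seq c n) (½ ℚ.* ε))
            (cong (seq b n ℚ.+ seq c n ℚ.+_) (½+½ ε)))

        b+c≼a : b + c ≼ a
        b+c≼a = ≼-trans
          (+-mono-≼
            (≼-limit {b} {0ℝ} λ ε 0<ε → ≼-trans
              (outer≼ hb (covered-⊆ {A = E ∩ A} {B = A} (λ _ → proj₂) (null ε 0<ε)))
              (≼-reflexive λ _ → sym (ℚ.+-identityˡ ε)))
            (≼-limit {c} {a} λ ε 0<ε →
              outer≼ hc (covered-⊆ {A = E ∩ ∁ A} {B = E} (λ _ → proj₁) (outer-approximation ha ε 0<ε))))
          (≼-reflexive λ n → ℚ.+-identityˡ (seq a n))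

      null⇒measureZero : ∀ {s A} → Null s A → HasMeasure s A 0ℝ
      null⇒measureZero null = null⇒measurable null , isOuterMeasure covered-nonneg
        λ ε 0<ε → fromℚ ε , null ε 0<ε , ≼-reflexive λ _ → sym (ℚ.+-identityˡ ε)

      measureZero⇒null : ∀ {s A} → HasMeasure s A 0ℝ → Null s A
      measureZero⇒null (_ , h) ε 0<ε =
        covered-≼ (≼-reflexive λ _ → ℚ.+-identityˡ ε) (outer-approximation {a = 0ℝ} h ε 0<ε)

      -- Only the test set E = 2^ω of the Carathéodory criterion is needed.
      measurable∧¬null⇒complement : ∀ {s A} → Measurable s A → ¬ Null s A →
        ∃[ δ ] ∃[ v ] (0ℚ ℚ.< δ × Covered s (∁ A) v × v + fromℚ δ ≼ 1ℝ)
      measurable∧¬null⇒complement {s} {A} meas ¬null =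
        let U = λ _ → ⊤
            (ε , k) = ¬∀⇒∃¬ ¬null
            (0<ε , ¬cov) = ¬→⇒×¬ k
            (a , ha) = exists-outerMeasure s U
            (b , hb) = exists-outerMeasure s (U ∩ A)
            (c , hc) = exists-outerMeasure s (U ∩ ∁ A)
            -- As A has no cover of mass ε, b ≥ ε / 2, and b + c ≤ 1 leaves c ≤ 1 - 2 δ for δ = ε /
            -- 4: one δ pays for approximating c by a cover, the other is the gap.
            ε≼b+½ε = [ (λ l → l) , (λ l → ⊥-elim (¬cov (covered-≼ l (covered-⊆ {A = A} {B = U ∩ A} (λ _ Ax → tt , Ax)
              (outer-approximation hb (½ ℚ.* ε) (0<½*ℚ 0<ε)))))) ]′ (≼-total (fromℚ ε) (b + fromℚ (½ ℚ.* ε)))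
            b+c≼1 = ≼-trans (wrap (proj₂ (meas U a b c ha hb hc))) (outer≼ {s} {U} {a} ha (covered-by-whole s U))
            δ = ½ ℚ.* (½ ℚ.* ε)
        in δ , c + fromℚ δ , 0<½*ℚ (0<½*ℚ 0<ε)
         , covered-⊆ {A = ∁ A} {B = U ∩ ∁ A} (λ _ ¬Ax → tt , ¬Ax) (outer-approximation hc δ (0<½*ℚ (0<½*ℚ 0<ε)))
         , ≼-from-difference ((1ℝ - (b + c)) + ((b + fromℚ (½ ℚ.* ε)) - fromℚ ε))
             (0≼+ (0≼- b+c≼1) (0≼- ε≼b+½ε))
             λ n → trans (cong₂ (λ d e → seq c n ℚ.+ δ ℚ.+ δ ℚ.+ ((1ℚ ℚ.- (seq b n ℚ.+ seq c n)) ℚ.+ ((seq b n ℚ.+ d) ℚ.- e)))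
                 (sym (½+½ (½ ℚ.* ε))) (sym (trans (cong₂ ℚ._+_ (½+½ (½ ℚ.* ε)) (½+½ (½ ℚ.* ε))) (½+½ ε))))
               (solve 3 (λ b c d → c :+ d :+ d :+ ((con 1ℚ :- (b :+ c)) :+ ((b :+ (d :+ d)) :- ((d :+ d) :+ (d :+ d)))) := con 1ℚ)
                 refl (seq b n) (seq c n) δ)

open Covering

-- Martingales on the binary tree and their maximal inequality.

module MaximalInequality where

  -- Words as numerals in bijective base two, least significant digit first

  increment : List Bool → List Bool
  increment []          = false ∷ []
  increment (false ∷ τ) = true ∷ τ
  increment (true ∷ τ)  = false ∷ increment τ

  word : ℕ → List Bool
  word zero    = []
  word (suc n) = increment (word n)

  double : ℕ → ℕ
  double zero    = zero
  double (suc n) = suc (suc (double n))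

  code : List Bool → ℕ
  code []          = 0
  code (false ∷ τ) = suc (double (code τ))
  code (true ∷ τ)  = suc (suc (double (code τ)))

  -- The number 2^l - 1 of words of length below l. They come first in the enumeration `word`, so
  -- partial sums up to here are sums over complete levels of the tree.
  wordsBelow : ℕ → ℕ
  wordsBelow zero    = zero
  wordsBelow (suc l) = suc (double (wordsBelow l))

  prefix : Cantor → ℕ → List Bool
  prefix X zero    = []
  prefix X (suc n) = X 0 ∷ prefix (X ∘ suc) n

  abstract

    word-odd : ∀ n → word (suc (double n)) ≡ false ∷ word n
    word-odd zero    = refl
    word-odd (suc n) = cong (increment ∘ increment) (word-odd n)

    word-even : ∀ n → word (suc (suc (double n))) ≡ true ∷ word n
    word-even n = cong increment (word-odd n)

    word-code : ∀ τ → word (code τ) ≡ τ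
    word-code []          = refl
    word-code (false ∷ τ) = trans (word-odd (code τ)) (cong (false ∷_) (word-code τ))
    word-code (true ∷ τ)  = trans (word-even (code τ)) (cong (true ∷_) (word-code τ))

    n≤double : ∀ n → n ℕ.≤ double n
    n≤double zero    = ℕ.z≤n
    n≤double (suc n) = ℕ.s≤s (ℕ.m≤n⇒m≤1+n (n≤double n))

    n≤wordsBelow : ∀ n → n ℕ.≤ wordsBelow n
    n≤wordsBelow zero    = ℕ.z≤n
    n≤wordsBelow (suc n) = ℕ.s≤s (ℕ.≤-trans (n≤wordsBelow n) (n≤double _))

    -- With the least significant digit first, the odd and the positive even numerals enumerate the
    -- words starting with `false` and with `true`, so a sum over the tree splits into the root and
    -- two subtrees.
    partialSum-word : ∀ (f : List Bool → ℝ) m → partialSum (f ∘ word) (suc (double m)) ≼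
      f [] + (partialSum (f ∘ (false ∷_) ∘ word) m + partialSum (f ∘ (true ∷_) ∘ word) m)
    partialSum-word f zero    = ≼-reflexive λ n → ℚ.+-comm 0ℚ (seq (f []) n)
    partialSum-word f (suc m) = ≼-trans
      (+-mono-≼ (+-mono-≼ (partialSum-word f m)
          (≼-reflexive {y = f (false ∷ word m)} λ n → cong (λ τ → seq (f τ) n) (word-odd m)))
        (≼-reflexive {y = f (true ∷ word m)} λ n → cong (λ τ → seq (f τ) n) (word-even m)))
      (≼-reflexive λ n → solve 5 (λ e F T a b → ((e :+ (F :+ T)) :+ a) :+ b := e :+ ((F :+ a) :+ (T :+ b))) refl
        (seq (f []) n) (seq (partialSum (f ∘ (false ∷_) ∘ word) m) n) (seq (partialSum (f ∘ (true ∷_) ∘ word) m) n)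
        (seq (f (false ∷ word m)) n) (seq (f (true ∷ word m)) n))

    partialSum-scaled : ∀ {f g} α → (∀ i → f i ≼ α * g i) → ∀ m → partialSum f m ≼ α * partialSum g m
    partialSum-scaled α h zero    = ≼-reflexive λ n → sym (ℚ.*-zeroʳ (seq α n))
    partialSum-scaled {f} {g} α h (suc m) = ≼-trans (+-mono-≼ (partialSum-scaled α h m) (h m))
      (≼-reflexive λ n → sym (ℚ.*-distribˡ-+ (seq α n) (seq (partialSum g m) n) (seq (g m) n)))

    partialSum-zero : ∀ {f} → (∀ i → f i ≼ 0ℝ) → ∀ m → partialSum f m ≼ 0ℝ
    partialSum-zero h zero    = ≼-refl
    partialSum-zero h (suc m) = ≼-trans (+-mono-≼ (partialSum-zero h m) (h m)) (≼-reflexive λ _ → refl)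

  module FirstCrossing (em : ∀ ℓ → ExcludedMiddle ℓ) where

    empty-if : ∀ {P : Set} → Dec P → Maybe (List Bool)
    empty-if (yes _) = just []
    empty-if (no _)  = nothing

    nothing-if : ∀ {P : Set} → Dec P → Maybe (List Bool) → Maybe (List Bool)
    nothing-if (yes _) x = nothing
    nothing-if (no _)  x = x

    -- Keeps a word exactly if it lies in `C` and no proper prefix does, so that the kept cylinders
    -- are disjoint. Recursion from the root makes the restriction to a subtree again a
    -- `firstCrossing`.
    firstCrossing : (List Bool → Set) → List Bool → Maybe (List Bool)
    firstCrossing C []      = empty-if (em 0ℓ {C []})
    firstCrossing C (b ∷ τ) = nothing-if (em 0ℓ {C []}) (Maybe.map (b ∷_) (firstCrossing (C ∘ (b ∷_)) τ))

    crossingCover : (List Bool → Set) → ℕ → Maybe (List Bool)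
    crossingCover C = firstCrossing C ∘ word

    abstract

      firstCrossing-yes : ∀ C → C [] → firstCrossing C [] ≡ just [] × (∀ b τ → firstCrossing C (b ∷ τ) ≡ nothing)
      firstCrossing-yes C h with em 0ℓ {C []}
      ... | yes _ = refl , λ _ _ → refl
      ... | no ¬h = ⊥-elim (¬h h)

      firstCrossing-no : ∀ C → ¬ C [] → firstCrossing C [] ≡ nothing ×
        (∀ b τ → firstCrossing C (b ∷ τ) ≡ Maybe.map (b ∷_) (firstCrossing (C ∘ (b ∷_)) τ))
      firstCrossing-no C ¬h with em 0ℓ {C []}
      ... | yes h = ⊥-elim (¬h h)
      ... | no _  = refl , λ _ _ → refl

      firstCrossing-covers : ∀ C X n → C (prefix X n) → ∃[ τ ] maybe′ (X Extends_) ⊥ (firstCrossing C τ)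
      firstCrossing-covers C X zero h =
        [] , subst (maybe′ (X Extends_) ⊥) (sym (proj₁ (firstCrossing-yes C h))) tt
      firstCrossing-covers C X (suc n) h = case em 0ℓ {C []} of λ
        { (yes k) → [] , subst (maybe′ (X Extends_) ⊥) (sym (proj₁ (firstCrossing-yes C k))) tt
        ; (no ¬k) →
            let (τ , e) = firstCrossing-covers (C ∘ (X 0 ∷_)) (X ∘ suc) n h in
            X 0 ∷ τ , subst (maybe′ (X Extends_) ⊥) (sym (proj₂ (firstCrossing-no C ¬k) (X 0) τ))
              (extends (firstCrossing (C ∘ (X 0 ∷_)) τ) e) }
        where
        extends : ∀ x → maybe′ ((X ∘ suc) Extends_) ⊥ x → maybe′ (X Extends_) ⊥ (Maybe.map (X 0 ∷_) x)
        extends (just σ) e = refl , e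

      crossingCover-covers : ∀ C X n → C (prefix X n) → ∃[ i ] maybe′ (X Extends_) ⊥ (crossingCover C i)
      crossingCover-covers C X n h = let (τ , e) = firstCrossing-covers C X n h in
        code τ , subst (λ τ → maybe′ (X Extends_) ⊥ (firstCrossing C τ)) (sym (word-code τ)) e

      mass-map : ∀ s b x → mass s (Maybe.map (b ∷_) x) ≼ bias (s 0) b * mass (s ∘ suc) x
      mass-map s b (just σ) = ≼-refl
      mass-map s b nothing  = ≼-reflexive λ n → sym (ℚ.*-zeroʳ (seq (bias (s 0) b) n))

      mass-≡ : ∀ s {x y} → x ≡ y → mass s x ≼ mass s y
      mass-≡ s refl = ≼-refl

      0≼t* : ∀ t → t * 0ℝ ≼ 0ℝ
      0≼t* t = ≼-reflexive λ n → ℚ.*-zeroʳ (seq t n)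

      -- Ville's maximal inequality.  The second index of S stands for the number of terms
      -- of a series, so that no limit has to be taken.
      ville : ∀ {s} t → 0ℝ ≼ t → AreProbabilities s → (S : List Bool → ℕ → ℝ) →
        (∀ τ k → 0ℝ ≼ S τ k) → (∀ τ {k l} → k ℕ.≤ l → S τ k ≼ S τ l) →
        (∀ τ k → s (length τ) * S (τ ∷ʳ true) k + (1ℝ - s (length τ)) * S (τ ∷ʳ false) k ≼ S τ k) →
        ∀ l → ∃[ K ] (∀ k → K ℕ.≤ k →
          t * total s (crossingCover (λ τ → ∃[ j ] t ≼ S τ j)) (wordsBelow l) ≼ S [] k)
      ville t 0≼t hs S S≽0 S-mono S-mart zero = 0 , λ k _ → ≼-trans (0≼t* t) (S≽0 [] k)
      ville {s} t 0≼t hs S S≽0 S-mono S-mart (suc l) = case em 0ℓ {C []} of λ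
        -- The root crosses already, so it alone forms the cover, with mass one.
        { (yes h) → let (j , t≼) = h ; (e , e′) = firstCrossing-yes C h in
            j , λ k j≤k → ≼-trans
              (*-monoʳ-≼ t 0≼t (≼-trans (partialSum-word (mass s ∘ firstCrossing C) N)
                (≼-trans {y = 1ℝ + (0ℝ + 0ℝ)}
                  (+-mono-≼ (mass-≡ s e) (+-mono-≼
                    (partialSum-zero (λ i → mass-≡ s (e′ false (word i))) N)
                    (partialSum-zero (λ i → mass-≡ s (e′ true (word i))) N)))
                  (≼-reflexive {y = 1ℝ} λ _ → refl))))
              (≼-trans (≼-reflexive λ n → ℚ.*-identityʳ (seq t n)) (≼-trans t≼ (S-mono [] j≤k)))
        -- The cover is the union of those of the two subtrees, whose bounds average to at most S at
        -- the root.
        ; (no ¬h) →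
            let (e , e′) = firstCrossing-no C ¬h
                (K₁ , h₁) = subtree true
                (K₀ , h₀) = subtree false
            in K₁ ℕ.⊔ K₀ , λ k K≤k → ≼-trans
              (*-monoʳ-≼ t 0≼t (≼-trans (partialSum-word (mass s ∘ firstCrossing C) N)
                (+-mono-≼ (mass-≡ s e) (+-mono-≼ (branch e′ false) (branch e′ true)))))
              (≼-trans {y = s 0 * (t * subtotal true) + (1ℝ - s 0) * (t * subtotal false)}
                (≼-reflexive λ n → solve 4 (λ t p x y → t :* (con 0ℚ :+ ((con 1ℚ :- p) :* x :+ p :* y)) := p :* (t :* y) :+ (con 1ℚ :- p) :* (t :* x))
                  refl (seq t n) (seq (s 0) n) (seq (subtotal false) n) (seq (subtotal true) n))
                (≼-trans
                  (+-mono-≼ (*-monoʳ-≼ (s 0) (bias-nonneg (hs 0) true) (h₁ k (ℕ.m⊔n≤o⇒m≤o K₁ K₀ K≤k)))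
                    (*-monoʳ-≼ (1ℝ - s 0) (bias-nonneg (hs 0) false) (h₀ k (ℕ.m⊔n≤o⇒n≤o K₁ K₀ K≤k))))
                  (S-mart [] k))) }
        where
        N : ℕ
        N = wordsBelow l
        C : List Bool → Set
        C τ = ∃[ j ] t ≼ S τ j
        subtotal : Bool → ℝ
        subtotal b = total (s ∘ suc) (crossingCover (C ∘ (b ∷_))) N
        subtree : ∀ b → ∃[ K ] (∀ k → K ℕ.≤ k → t * subtotal b ≼ S (b ∷ []) k)
        subtree b = ville t 0≼t (hs ∘ suc) (S ∘ (b ∷_)) (S≽0 ∘ (b ∷_)) (λ τ → S-mono (b ∷ τ))
          (S-mart ∘ (b ∷_)) l
        branch : (∀ b τ → firstCrossing C (b ∷ τ) ≡ Maybe.map (b ∷_) (firstCrossing (C ∘ (b ∷_)) τ)) →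
          ∀ b → partialSum (mass s ∘ firstCrossing C ∘ (b ∷_) ∘ word) N ≼ bias (s 0) b * subtotal b
        branch e b = partialSum-scaled (bias (s 0) b) (λ i →
          ≼-trans (mass-≡ s (e b (word i))) (mass-map s b (firstCrossing (C ∘ (b ∷_)) (word i)))) N

  -- A kernel k moves x to the product measure with weights k n (x n).  In mix k z τ
  -- only the bits of τ have been revealed, and z is the average of k over the others.

  mix : (ℕ → Bool → ℝ) → (ℕ → ℝ) → List Bool → ℕ → ℝ
  mix k z []      n       = z n
  mix k z (b ∷ τ) zero    = k 0 b
  mix k z (b ∷ τ) (suc n) = mix (k ∘ suc) (z ∘ suc) τ n

  -- If X has law s and Z has weights `k n (X n)` given X, then Z has law z: this is what the
  -- averages express. The reverse inequality `average⁻¹` serves the bits `false`.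
  record IsKernel (s : ℕ → ℝ) (k : ℕ → Bool → ℝ) (z : ℕ → ℝ) : Set where
    field
      source  : AreProbabilities s
      kernel  : ∀ n b → IsProbability (k n b)
      target  : AreProbabilities z
      average : ∀ n → s n * k n true + (1ℝ - s n) * k n false ≼ z n
      average⁻¹ : ∀ n → z n ≼ s n * k n true + (1ℝ - s n) * k n false

  open IsKernel

  wordLength : Maybe (List Bool) → ℕ
  wordLength = maybe′ length 0

  maxLength : (ℕ → Maybe (List Bool)) → ℕ → ℕ
  maxLength c zero    = 0
  maxLength c (suc m) = maxLength c m ℕ.⊔ wordLength (c m)

  abstract

    shift : ∀ {s k z} → IsKernel s k z → IsKernel (s ∘ suc) (k ∘ suc) (z ∘ suc)
    shift κ = record
      { source = source κ ∘ suc ; kernel = kernel κ ∘ suc ; target = target κ ∘ suc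
      ; average = average κ ∘ suc ; average⁻¹ = average⁻¹ κ ∘ suc }

    mix-probabilities : ∀ {s k z} → IsKernel s k z → ∀ τ → AreProbabilities (mix k z τ)
    mix-probabilities κ []      n       = target κ n
    mix-probabilities κ (b ∷ τ) zero    = kernel κ 0 b
    mix-probabilities κ (b ∷ τ) (suc n) = mix-probabilities (shift κ) τ n

    bias-average : ∀ {s k z} → IsKernel s k z → ∀ b →
      s 0 * bias (k 0 true) b + (1ℝ - s 0) * bias (k 0 false) b ≼ bias (z 0) b
    bias-average κ true = average κ 0
    bias-average {s} {k} {z} κ false = ≼-from-difference
      ((s 0 * k 0 true + (1ℝ - s 0) * k 0 false) - z 0) (0≼- (average⁻¹ κ 0)) λ n →
      solve 4 (λ p a b z → (p :* (con 1ℚ :- a) :+ (con 1ℚ :- p) :* (con 1ℚ :- b)) :+ ((p :* a :+ (con 1ℚ :- p) :* b) :- z) := con 1ℚ :- z)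
        refl (seq (s 0) n) (seq (k 0 true) n) (seq (k 0 false) n) (seq (z 0) n)

    -- Revealing one more bit changes the weight of one coordinate only, and the measure of a
    -- cylinder is a product, affine in each weight; so the averaging acts on a single factor.
    cylinderMeasure-martingale : ∀ {s k z} → IsKernel s k z → ∀ τ σ →
      s (length τ) * cylinderMeasure (mix k z (τ ∷ʳ true)) σ
        + (1ℝ - s (length τ)) * cylinderMeasure (mix k z (τ ∷ʳ false)) σ
      ≼ cylinderMeasure (mix k z τ) σ
    cylinderMeasure-martingale {s} κ τ [] = ≼-reflexive λ n →
      solve 1 (λ p → p :* con 1ℚ :+ (con 1ℚ :- p) :* con 1ℚ := con 1ℚ) refl (seq (s (length τ)) n)
    cylinderMeasure-martingale {s} {k} {z} κ [] (b ∷ σ) = ≼-trans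
      {y = Q * (s 0 * bias (k 0 true) b + (1ℝ - s 0) * bias (k 0 false) b)}
      (≼-reflexive λ n → solve 4 (λ p x y q → p :* (x :* q) :+ (con 1ℚ :- p) :* (y :* q) := q :* (p :* x :+ (con 1ℚ :- p) :* y))
        refl (seq (s 0) n) (seq (bias (k 0 true) b) n) (seq (bias (k 0 false) b) n) (seq Q n))
      (≼-trans (*-monoʳ-≼ Q (cylinderMeasure-nonneg (target κ ∘ suc) σ) (bias-average κ b))
        (≼-reflexive λ n → ℚ.*-comm (seq Q n) (seq (bias (z 0) b) n)))
      where
      Q : ℝ
      Q = cylinderMeasure (z ∘ suc) σ
    cylinderMeasure-martingale {s} {k} {z} κ (x ∷ τ) (b ∷ σ) = ≼-trans
      {y = h * (a * Q true + (1ℝ - a) * Q false)}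
      (≼-reflexive λ n → solve 4 (λ p x y h → p :* (h :* x) :+ (con 1ℚ :- p) :* (h :* y) := h :* (p :* x :+ (con 1ℚ :- p) :* y))
        refl (seq a n) (seq (Q true) n) (seq (Q false) n) (seq h n))
      (*-monoʳ-≼ h (bias-nonneg (kernel κ 0 x) b) (cylinderMeasure-martingale (shift κ) τ σ))
      where
      h a : ℝ
      h = bias (k 0 x) b
      a = s (suc (length τ))
      Q : Bool → ℝ
      Q y = cylinderMeasure (mix (k ∘ suc) (z ∘ suc) (τ ∷ʳ y)) σ

    mass-martingale : ∀ {s k z} → IsKernel s k z → ∀ τ x →
      s (length τ) * mass (mix k z (τ ∷ʳ true)) x + (1ℝ - s (length τ)) * mass (mix k z (τ ∷ʳ false)) x
      ≼ mass (mix k z τ) x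
    mass-martingale κ τ (just σ) = cylinderMeasure-martingale κ τ σ
    mass-martingale {s} κ τ nothing = ≼-reflexive λ n →
      solve 1 (λ p → p :* con 0ℚ :+ (con 1ℚ :- p) :* con 0ℚ := con 0ℚ) refl (seq (s (length τ)) n)

    -- A word of length at most n sees only coordinates below n, where `mix` agrees with the kernel
    -- at X.
    mix-prefix : ∀ k z X n x → wordLength x ℕ.≤ n →
      mass (mix k z (prefix X n)) x ≡ mass (λ i → k i (X i)) x
    mix-prefix k z X n nothing h = refl
    mix-prefix k z X n (just σ) h = go k z X n σ h
      where
      go : ∀ k z X n σ → length σ ℕ.≤ n →
        cylinderMeasure (mix k z (prefix X n)) σ ≡ cylinderMeasure (λ i → k i (X i)) σ
      go k z X n       []      h           = refl
      go k z X (suc n) (b ∷ σ) (ℕ.s≤s h) =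
        cong (bias (k 0 (X 0)) b *_) (go (k ∘ suc) (z ∘ suc) (X ∘ suc) n σ h)

    total-mix-prefix : ∀ k z X n c m → maxLength c m ℕ.≤ n →
      total (mix k z (prefix X n)) c m ≡ total (λ i → k i (X i)) c m
    total-mix-prefix k z X n c zero    h = refl
    total-mix-prefix k z X n c (suc m) h = cong₂ _+_
      (total-mix-prefix k z X n c m (ℕ.m⊔n≤o⇒m≤o (maxLength c m) _ h))
      (mix-prefix k z X n (c m) (ℕ.m⊔n≤o⇒n≤o (maxLength c m) _ h))

  module Markov (em : ∀ ℓ → ExcludedMiddle ℓ) where

    open FirstCrossing em

    abstract

      -- The maximal inequality applied to the conditional mass of c given the revealed bits: it is
      -- at most v at the root, and along X each of its partial sums attains its final value after
      -- finitely many bits. Crossing t costs mass v / t, and d is 1 / t.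
      markov : ∀ {s k z} → IsKernel s k z → ∀ c v → (∀ m → total z c m ≼ v) →
        ∀ {t d} → 0ℚ ℚ.< t → 0ℚ ℚ.< d → t ℚ.* d ≡ 1ℚ →
        Covered s (λ X → ∃[ m ] fromℚ t ≼ total (λ i → k i (X i)) c m) (fromℚ d * v)
      markov {s} {k} {z} κ c v h {t} {d} 0<t 0<d td≡1 = covering (crossingCover C)
        (λ X (m , t≼) → crossingCover-covers C X (maxLength c m)
          (m , subst (fromℚ t ≼_) (sym (total-mix-prefix k z X (maxLength c m) c m ℕ.≤-refl)) t≼))
        λ m → ≼-trans {y = fromℚ d * (fromℚ t * total s (crossingCover C) m)}
          (≼-reflexive λ n → sym (trans (sym (ℚ.*-assoc d t _))
            (trans (cong (ℚ._* seq (total s (crossingCover C) m) n) (trans (ℚ.*-comm d t) td≡1)) (ℚ.*-identityˡ _))))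
          (*-monoʳ-≼ (fromℚ d) (0≼fromℚ 0<d) (bound m))
        where
        S : List Bool → ℕ → ℝ
        S τ m = total (mix k z τ) c m
        C : List Bool → Set
        C τ = ∃[ m ] fromℚ t ≼ S τ m

        bound : ∀ m → fromℚ t * total s (crossingCover C) m ≼ v
        bound m =
          let (K , p) = ville {s} (fromℚ t) (0≼fromℚ 0<t) (source κ) S
                (λ τ → partialSum-nonneg (λ i → mass-nonneg (mix-probabilities κ τ) (c i)))
                (λ τ → partialSum-monotone (λ i → mass-nonneg (mix-probabilities κ τ) (c i)))
                (λ τ → partialSum-combination (s (length τ)) (1ℝ - s (length τ)) (λ i → mass-martingale κ τ (c i)))
                m
          -- Since m ≤ 2^m - 1, the first m terms are among those of the levels below m.
          in ≼-trans (*-monoʳ-≼ (fromℚ t) (0≼fromℚ 0<t)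
               (partialSum-monotone (λ i → mass-nonneg (source κ) (crossingCover C i)) (n≤wordsBelow m)))
             (≼-trans (p K ℕ.≤-refl) (h K))

open MaximalInequality

-- Sequences and coupled pairs that avoid covers of small mass.

module Avoidance where

  -- What remains of a cylinder after the bit b has been read: `nothing` if it has been left, and
  -- `just []`, of mass one, once it has been entered for good.
  derivative : Bool → Maybe (List Bool) → Maybe (List Bool)
  derivative b     nothing             = nothing
  derivative b     (just [])           = just []
  derivative true  (just (true ∷ σ))   = just σ
  derivative true  (just (false ∷ σ))  = nothing
  derivative false (just (true ∷ σ))   = nothing
  derivative false (just (false ∷ σ))  = just σ

  -- J is the joint law of two bits; inequalities suffice since the weights on both
  -- sides sum to one.
  record IsCoupling (J : Bool → Bool → ℝ) (p q : ℝ) : Set where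
    field
      nonneg : ∀ a b → 0ℝ ≼ J a b
      mass≽1 : 1ℝ ≼ J true true + (J true false + (J false true + (J false false + 0ℝ)))
      left   : ∀ a → J a true + J a false ≼ bias p a
      right  : ∀ b → J true b + J false b ≼ bias q b

  open IsCoupling

  -- Two couplings of a bit with itself: always equal, and never both one. The entry 1 - 2 p of the
  -- latter is nonnegative when p ≤ ½.
  diagonal disjoint : ℝ → Bool → Bool → ℝ
  diagonal p true  true  = p
  diagonal p true  false = 0ℝ
  diagonal p false true  = 0ℝ
  diagonal p false false = 1ℝ - p
  disjoint p true  true  = 0ℝ
  disjoint p true  false = p
  disjoint p false true  = p
  disjoint p false false = 1ℝ - p - p

  sumOver : ∀ {A : Set} → List A → (A → ℝ) → ℝ
  sumOver []       f = 0ℝ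
  sumOver (x ∷ xs) f = f x + sumOver xs f

  abstract

    derivative-head : ∀ b σ → derivative b (just (b ∷ σ)) ≡ just σ
    derivative-head true  σ = refl
    derivative-head false σ = refl

    -- The law of total probability for the first bit.
    mass-derivative : ∀ s x →
      s 0 * mass (s ∘ suc) (derivative true x) + (1ℝ - s 0) * mass (s ∘ suc) (derivative false x) ≼ mass s x
    mass-derivative s nothing = ≼-reflexive λ n →
      solve 1 (λ p → p :* con 0ℚ :+ (con 1ℚ :- p) :* con 0ℚ := con 0ℚ) refl (seq (s 0) n)
    mass-derivative s (just []) = ≼-reflexive λ n →
      solve 1 (λ p → p :* con 1ℚ :+ (con 1ℚ :- p) :* con 1ℚ := con 1ℚ) refl (seq (s 0) n)
    mass-derivative s (just (true ∷ σ)) = ≼-reflexive λ n →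
      solve 2 (λ p x → p :* x :+ (con 1ℚ :- p) :* con 0ℚ := p :* x) refl
        (seq (s 0) n) (seq (cylinderMeasure (s ∘ suc) σ) n)
    mass-derivative s (just (false ∷ σ)) = ≼-reflexive λ n →
      solve 2 (λ p x → p :* con 0ℚ :+ (con 1ℚ :- p) :* x := (con 1ℚ :- p) :* x) refl
        (seq (s 0) n) (seq (cylinderMeasure (s ∘ suc) σ) n)

    total-derivative : ∀ s c m →
      s 0 * total (s ∘ suc) (derivative true ∘ c) m + (1ℝ - s 0) * total (s ∘ suc) (derivative false ∘ c) m ≼ total s c m
    total-derivative s c = partialSum-combination (s 0) (1ℝ - s 0) (λ i → mass-derivative s (c i))

    diagonal-isCoupling : ∀ {p} → IsProbability p → IsCoupling (diagonal p) p p
    diagonal-isCoupling {p} (0≼p , p≼1) = record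
      { nonneg = λ { true true → 0≼p ; true false → ≼-refl ; false true → ≼-refl ; false false → 0≼- p≼1 }
      ; mass≽1 = ≼-reflexive λ n →
          solve 1 (λ p → con 1ℚ := p :+ (con 0ℚ :+ (con 0ℚ :+ ((con 1ℚ :- p) :+ con 0ℚ)))) refl (seq p n)
      ; left   = λ { true → ≼-reflexive λ n → ℚ.+-identityʳ _ ; false → ≼-reflexive λ n → ℚ.+-identityˡ _ }
      ; right  = λ { true → ≼-reflexive λ n → ℚ.+-identityʳ _ ; false → ≼-reflexive λ n → ℚ.+-identityˡ _ } }

    disjoint-isCoupling : ∀ {p} → 0ℝ ≼ p → p ≼ ½ℝ → IsCoupling (disjoint p) p p
    disjoint-isCoupling {p} 0≼p p≼½ = record
      { nonneg = λ { true true → ≼-refl ; true false → 0≼p ; false true → 0≼p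
                   ; false false → ≼-from-difference ((½ℝ - p) + (½ℝ - p)) (0≼+ (0≼- p≼½) (0≼- p≼½))
                       λ n → solve 1 (λ p → con 0ℚ :+ ((con ½ :- p) :+ (con ½ :- p)) := con 1ℚ :- p :- p) refl (seq p n) }
      ; mass≽1 = ≼-reflexive λ n →
          solve 1 (λ p → con 1ℚ := con 0ℚ :+ (p :+ (p :+ ((con 1ℚ :- p :- p) :+ con 0ℚ)))) refl (seq p n)
      ; left   = λ { true → ≼-reflexive λ n → ℚ.+-identityˡ _ ; false → ≼-reflexive λ n → split-rest (seq p n) }
      ; right  = λ { true → ≼-reflexive λ n → ℚ.+-identityˡ _ ; false → ≼-reflexive λ n → split-rest (seq p n) } }
      where
      split-rest : ∀ p → p ℚ.+ (1ℚ ℚ.- p ℚ.- p) ≡ 1ℚ ℚ.- p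
      split-rest = solve 1 (λ p → p :+ (con 1ℚ :- p :- p) := con 1ℚ :- p) refl

    sumOver-mono : ∀ {A : Set} {f g : A → ℝ} → (∀ x → f x ≼ g x) → ∀ xs → sumOver xs f ≼ sumOver xs g
    sumOver-mono h []       = ≼-refl
    sumOver-mono h (x ∷ xs) = +-mono-≼ (h x) (sumOver-mono h xs)

  -- The method of conditional expectations.

  module Descent (em : ∀ ℓ → ExcludedMiddle ℓ) where

    open Order em

    abstract

      -- If every a of positive weight exceeds v at some stage, then by monotonicity those in the
      -- list exceed v by a common ε from a common stage M on, and the weighted sum grows
      -- accordingly. Entries of weight zero contribute nothing.
      some≼average : ∀ {A : Set} {w : A → ℝ} {x : A → ℕ → ℝ} {v} →
        (∀ a → 0ℝ ≼ w a) → (∀ a m → 0ℝ ≼ x a m) → (∀ a {m n} → m ℕ.≤ n → x a m ≼ x a n) → 0ℝ ≼ v →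
        ∀ as →
        (∃[ a ] (¬ (w a ≼ 0ℝ) × (∀ m → x a m ≼ v))) ⊎
        (∃[ ε ] (0ℚ ℚ.< ε × ∃[ M ] (∀ m → M ℕ.≤ m →
          sumOver as (λ a → w a * (v + fromℚ ε)) ≼ sumOver as (λ a → w a * x a m))))
      some≼average hw hx x-mono 0≼v [] = inj₂ (1ℚ , 0<1ℚ , 0 , λ _ _ → ≼-refl)
      some≼average {A} {w} {x} {v} hw hx x-mono 0≼v (a ∷ as) =
        case some≼average {w = w} {x} hw hx x-mono 0≼v as of λ
        { (inj₁ found) → inj₁ found
        ; (inj₂ (ε , 0<ε , M , h)) → case em 0ℓ {w a ≼ 0ℝ} of λ
          { (yes wa≼0) → inj₂ (ε , 0<ε , M , λ m M≤m → +-mono-≼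
              (≼-trans (zero-weight wa≼0 ε 0<ε) (0≼* (hw a) (hx a m))) (h m M≤m))
          ; (no wa⋠0) → case em 0ℓ {∀ m → x a m ≼ v} of λ
            { (yes xa≼v) → inj₁ (a , wa⋠0 , xa≼v)
            ; (no xa⋠v) →
                let (k , xak⋠v) = ¬∀⇒∃¬ xa⋠v
                    (δ , 0<δ , v+δ≼) = ⋠⇒+fromℚ≼ xak⋠v
                in inj₂ (ε ℚ.⊓ δ , smaller 0<ε 0<δ , M ℕ.⊔ k , λ m l → +-mono-≼
                     (*-monoʳ-≼ (w a) (hw a) (≼-trans (+-monoʳ-≼ v (fromℚ-mono (ℚ.p⊓q≤q ε δ)))
                       (≼-trans v+δ≼ (x-mono a (ℕ.m⊔n≤o⇒n≤o M k l)))))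
                     (≼-trans (sumOver-mono (λ b → *-monoʳ-≼ (w b) (hw b)
                         (+-monoʳ-≼ v (fromℚ-mono (ℚ.p⊓q≤p ε δ)))) as)
                       (h m (ℕ.m⊔n≤o⇒m≤o M k l)))) } } }
        where
        zero-weight : w a ≼ 0ℝ → ∀ ε → 0ℚ ℚ.< ε → w a * (v + fromℚ ε) ≼ 0ℝ
        zero-weight h ε 0<ε = ≼-trans {y = (v + fromℚ ε) * w a} (≼-reflexive λ n → ℚ.*-comm (seq (w a) n) _)
          (≼-trans (*-monoʳ-≼ (v + fromℚ ε) (0≼+ 0≼v (0≼fromℚ 0<ε)) h)
            (≼-reflexive λ n → ℚ.*-zeroʳ (seq (v + fromℚ ε) n)))
        smaller : ∀ {ε δ} → 0ℚ ℚ.< ε → 0ℚ ℚ.< δ → 0ℚ ℚ.< ε ℚ.⊓ δ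
        smaller {ε} {δ} 0<ε 0<δ = [ (λ e → subst (0ℚ ℚ.<_) (sym e) 0<ε) , (λ e → subst (0ℚ ℚ.<_) (sym e) 0<δ) ]′
          (ℚ.⊓-sel ε δ)

    -- The situation after finitely many bits: the laws of the remaining coordinates and the
    -- residual covers. The bound v is a parameter because it is invariant along the path.
    record State (v : ℝ) : Set where
      field
        J      : ℕ → Bool → Bool → ℝ
        s₁ s₂  : ℕ → ℝ
        c₁ c₂  : ℕ → Maybe (List Bool)
        prob₁  : AreProbabilities s₁
        prob₂  : AreProbabilities s₂
        coupling : ∀ n → IsCoupling (J n) (s₁ n) (s₂ n)
        bound  : ∀ m → total s₁ c₁ m + total s₂ c₂ m ≼ v

    open State

    abstract

      -- By the marginals of J, the residual mass of the two covers, averaged over the first pair of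
      -- bits, is at most v. So some pair of positive probability leaves at most v.
      choice : ∀ {v} (st : State v) → Σ[ ab ∈ Bool × Bool ] (¬ (J st 0 (proj₁ ab) (proj₂ ab) ≼ 0ℝ) ×
        (∀ m → total (s₁ st ∘ suc) (derivative (proj₁ ab) ∘ c₁ st) m
             + total (s₂ st ∘ suc) (derivative (proj₂ ab) ∘ c₂ st) m ≼ v))
      choice {v} st = [ (λ h → h) , (λ h → ⊥-elim (absurd h)) ]′
        (some≼average {w = w} {x} {v} (λ { (a , b) → nonneg κ a b })
          (λ { (a , b) m → 0≼+ (X≽0 a m) (Y≽0 b m) })
          (λ { (a , b) m≤n → +-mono-≼
            (partialSum-monotone (λ i → mass-nonneg (prob₁ st ∘ suc) (derivative a (c₁ st i))) m≤n)
            (partialSum-monotone (λ i → mass-nonneg (prob₂ st ∘ suc) (derivative b (c₂ st i))) m≤n) })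
          0≼v pairs)
        where
        κ : IsCoupling (J st 0) (s₁ st 0) (s₂ st 0)
        κ = coupling st 0
        p q : ℝ
        p = s₁ st 0
        q = s₂ st 0
        X Y : Bool → ℕ → ℝ
        X a = total (s₁ st ∘ suc) (derivative a ∘ c₁ st)
        Y b = total (s₂ st ∘ suc) (derivative b ∘ c₂ st)
        X≽0 : ∀ a m → 0ℝ ≼ X a m
        X≽0 a = partialSum-nonneg (λ i → mass-nonneg (prob₁ st ∘ suc) (derivative a (c₁ st i)))
        Y≽0 : ∀ b m → 0ℝ ≼ Y b m
        Y≽0 b = partialSum-nonneg (λ i → mass-nonneg (prob₂ st ∘ suc) (derivative b (c₂ st i)))
        w : Bool × Bool → ℝ
        w (a , b) = J st 0 a b
        x : Bool × Bool → ℕ → ℝ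
        x (a , b) m = X a m + Y b m
        pairs : List (Bool × Bool)
        pairs = (true , true) ∷ (true , false) ∷ (false , true) ∷ (false , false) ∷ []
        0≼v : 0ℝ ≼ v
        0≼v = ≼-trans (≼-reflexive λ _ → refl) (bound st 0)

        average≼v : ∀ m → sumOver pairs (λ a → w a * x a m) ≼ v
        average≼v m = ≼-trans
          {y = ((X true m * (w (true , true) + w (true , false)) + X false m * (w (false , true) + w (false , false)))
             + (Y true m * (w (true , true) + w (false , true)) + Y false m * (w (true , false) + w (false , false))))}
          (≼-reflexive λ n → solve 8 (λ tt tf ft ff X₁ X₀ Y₁ Y₀ →
              tt :* (X₁ :+ Y₁) :+ (tf :* (X₁ :+ Y₀) :+ (ft :* (X₀ :+ Y₁) :+ (ff :* (X₀ :+ Y₀) :+ con 0ℚ)))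
              := (X₁ :* (tt :+ tf) :+ X₀ :* (ft :+ ff)) :+ (Y₁ :* (tt :+ ft) :+ Y₀ :* (tf :+ ff))) refl
            (seq (w (true , true)) n) (seq (w (true , false)) n) (seq (w (false , true)) n) (seq (w (false , false)) n)
            (seq (X true m) n) (seq (X false m) n) (seq (Y true m) n) (seq (Y false m) n))
          (≼-trans
            (+-mono-≼
              (+-mono-≼ (*-monoʳ-≼ (X true m) (X≽0 true m) (left κ true)) (*-monoʳ-≼ (X false m) (X≽0 false m) (left κ false)))
              (+-mono-≼ (*-monoʳ-≼ (Y true m) (Y≽0 true m) (right κ true)) (*-monoʳ-≼ (Y false m) (Y≽0 false m) (right κ false))))
            (≼-trans {y = (p * X true m + (1ℝ - p) * X false m) + (q * Y true m + (1ℝ - q) * Y false m)}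
              (≼-reflexive λ n → cong₂ ℚ._+_
                (cong₂ ℚ._+_ (ℚ.*-comm (seq (X true m) n) _) (ℚ.*-comm (seq (X false m) n) _))
                (cong₂ ℚ._+_ (ℚ.*-comm (seq (Y true m) n) _) (ℚ.*-comm (seq (Y false m) n) _)))
              (≼-trans (+-mono-≼ (total-derivative (s₁ st) (c₁ st) m) (total-derivative (s₂ st) (c₂ st) m))
                (bound st m))))

        absurd : ¬ (∃[ ε ] (0ℚ ℚ.< ε × ∃[ M ] (∀ m → M ℕ.≤ m →
          sumOver pairs (λ a → w a * (v + fromℚ ε)) ≼ sumOver pairs (λ a → w a * x a m))))
        -- The weights sum to at least one, so the average would be at least v + ε.
        absurd (ε , 0<ε , M , h) = +fromℚ⋠ {v} 0<ε (≼-trans {y = (v + fromℚ ε) * 1ℝ}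
          (≼-reflexive λ n → sym (ℚ.*-identityʳ _))
          (≼-trans (*-monoʳ-≼ (v + fromℚ ε) (0≼+ 0≼v (0≼fromℚ 0<ε)) (mass≽1 κ))
            (≼-trans {y = sumOver pairs (λ a → w a * (v + fromℚ ε))}
              (≼-reflexive λ n → solve 5 (λ tt tf ft ff c →
                c :* (tt :+ (tf :+ (ft :+ (ff :+ con 0ℚ)))) := tt :* c :+ (tf :* c :+ (ft :* c :+ (ff :* c :+ con 0ℚ)))) refl
                (seq (w (true , true)) n) (seq (w (true , false)) n) (seq (w (false , true)) n) (seq (w (false , false)) n)
                (seq (v + fromℚ ε) n))
              (≼-trans (h M ℕ.≤-refl) (average≼v M)))))

    next : ∀ {v} → State v → State v
    next st = record
      { J = J st ∘ suc ; s₁ = s₁ st ∘ suc ; s₂ = s₂ st ∘ suc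
      ; c₁ = derivative (proj₁ (proj₁ (choice st))) ∘ c₁ st
      ; c₂ = derivative (proj₂ (proj₁ (choice st))) ∘ c₂ st
      ; prob₁ = prob₁ st ∘ suc ; prob₂ = prob₂ st ∘ suc ; coupling = coupling st ∘ suc
      ; bound = proj₂ (proj₂ (choice st)) }

    path : ∀ {v} → State v → ℕ → Bool × Bool
    path st zero    = proj₁ (choice st)
    path st (suc n) = path (next st) n

    abstract

      path-support : ∀ {v} (st : State v) n → ¬ (J st n (proj₁ (path st n)) (proj₂ (path st n)) ≼ 0ℝ)
      path-support st zero    = proj₁ (proj₂ (choice st))
      path-support st (suc n) = path-support (next st) n

      1≼total : ∀ {s} → AreProbabilities s → ∀ c i → 1ℝ ≼ mass s (c i) → 1ℝ ≼ total s c (suc i)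
      1≼total {s} h c i k = ≼-trans {y = 0ℝ + 1ℝ} (≼-reflexive λ _ → refl)
        (+-mono-≼ (partialSum-nonneg (λ j → mass-nonneg h (c j)) i) k)

      -- If the path ran through a word of the cover, following it would reduce that word to
      -- `just []`, of mass one, while the residual mass stays at most v < 1. The recursion is on
      -- the word.
      path-avoids₁ : ∀ {v δ} → 0ℚ ℚ.< δ → v + fromℚ δ ≼ 1ℝ → (st : State v) → ∀ i →
        ¬ maybe′ ((proj₁ ∘ path st) Extends_) ⊥ (c₁ st i)
      path-avoids₁ {v} {δ} 0<δ v+δ≼1 st i hit = go st (c₁ st i) refl hit
        where
        go : (st : State v) → ∀ x → c₁ st i ≡ x → ¬ maybe′ ((proj₁ ∘ path st) Extends_) ⊥ x
        go st (just []) e _ = +fromℚ⋠ {v} 0<δ (≼-trans v+δ≼1 (≼-trans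
          (1≼total (prob₁ st) (c₁ st) i (subst (λ x → 1ℝ ≼ mass (s₁ st) x) (sym e) ≼-refl))
          (≼-trans (≼+ʳ (partialSum-nonneg (λ j → mass-nonneg (prob₂ st) (c₂ st j)) (suc i))) (bound st (suc i)))))
        go st (just (b ∷ σ)) e (e₀ , ext) = go (next st) (just σ)
          (trans (cong (derivative (proj₁ (path st 0))) e)
            (trans (cong (λ a → derivative a (just (b ∷ σ))) e₀) (derivative-head b σ))) ext

      path-avoids₂ : ∀ {v δ} → 0ℚ ℚ.< δ → v + fromℚ δ ≼ 1ℝ → (st : State v) → ∀ i →
        ¬ maybe′ ((proj₂ ∘ path st) Extends_) ⊥ (c₂ st i)
      path-avoids₂ {v} {δ} 0<δ v+δ≼1 st i hit = go st (c₂ st i) refl hit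
        where
        go : (st : State v) → ∀ x → c₂ st i ≡ x → ¬ maybe′ ((proj₂ ∘ path st) Extends_) ⊥ x
        go st (just []) e _ = +fromℚ⋠ {v} 0<δ (≼-trans v+δ≼1 (≼-trans
          (1≼total (prob₂ st) (c₂ st) i (subst (λ x → 1ℝ ≼ mass (s₂ st) x) (sym e) ≼-refl))
          (≼-trans (≼+ˡ (partialSum-nonneg (λ j → mass-nonneg (prob₁ st) (c₁ st j)) (suc i))) (bound st (suc i)))))
          where
          ≼+ˡ : ∀ {x y} → 0ℝ ≼ y → x ≼ y + x
          ≼+ˡ {x} {y} h = ≼-from-difference y h λ n → ℚ.+-comm (seq x n) (seq y n)
        go st (just (b ∷ σ)) e (e₀ , ext) = go (next st) (just σ)
          (trans (cong (derivative (proj₂ (path st 0))) e)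
            (trans (cong (λ a → derivative a (just (b ∷ σ))) e₀) (derivative-head b σ))) ext

      -- A union bound: the covers catch one of the two sequences with probability at most v < 1, so
      -- some pair avoids both covers, and it can be chosen bit by bit inside the support of J.
      uncovered-pair : ∀ {J : ℕ → Bool → Bool → ℝ} {s₁ s₂ : ℕ → ℝ} {c₁ c₂ : ℕ → Maybe (List Bool)} {v δ} → AreProbabilities s₁ → AreProbabilities s₂ →
        (∀ n → IsCoupling (J n) (s₁ n) (s₂ n)) → (∀ m → total s₁ c₁ m + total s₂ c₂ m ≼ v) →
        0ℚ ℚ.< δ → v + fromℚ δ ≼ 1ℝ →
        Σ[ Z₁ ∈ Cantor ] Σ[ Z₂ ∈ Cantor ] ((∀ n → ¬ (J n (Z₁ n) (Z₂ n) ≼ 0ℝ)) ×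
          (∀ i → ¬ maybe′ (Z₁ Extends_) ⊥ (c₁ i)) × (∀ i → ¬ maybe′ (Z₂ Extends_) ⊥ (c₂ i)))
      uncovered-pair {J} {s₁} {s₂} {c₁} {c₂} {v} h₁ h₂ κ bound 0<δ v+δ≼1 =
        proj₁ ∘ path st , proj₂ ∘ path st , path-support st
          , path-avoids₁ 0<δ v+δ≼1 st , path-avoids₂ 0<δ v+δ≼1 st
        where
        st : State v
        st = record { J = J ; s₁ = s₁ ; s₂ = s₂ ; c₁ = c₁ ; c₂ = c₂
                    ; prob₁ = h₁ ; prob₂ = h₂ ; coupling = κ ; bound = bound }

open Avoidance

-- Kernels, point masses and finite changes of the weights.

module NullFilters where

  bit : Bool → ℝ
  bit b = if b then 1ℝ else 0ℝ

  -- Recursive, like `cylinderMeasure`, whose weights shift with each bit.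
  splice : ℕ → (ℕ → ℝ) → (ℕ → ℝ) → ℕ → ℝ
  splice zero    q p n       = p n
  splice (suc N) q p zero    = q 0
  splice (suc N) q p (suc n) = splice N (q ∘ suc) (p ∘ suc) n

  -- Ones are never removed, so a sequence in the support of the image contains the original one as
  -- a set.
  monotoneKernel : (ℕ → ℝ) → ℕ → Bool → ℝ
  monotoneKernel w n b = if b then 1ℝ else w n

  selectKernel : (ℕ → Bool) → (Bool → ℝ) → (ℕ → Bool → ℝ) → ℕ → Bool → ℝ
  selectKernel A f g n b = if A n then f b else g n b

  abstract

    bit-isProbability : ∀ b → IsProbability (bit b)
    bit-isProbability true  = 0≼1 , ≼-refl
    bit-isProbability false = ≼-refl , 0≼1

    ½≼1 : ½ℝ ≼ 1ℝ
    ½≼1 = fromℚ-mono (≤-fromℚ-difference ½ (ℚ.<⇒≤ 0<½ℚ) refl)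

    positive-gap : ∀ {x} → 0ℝ < x → ∃[ ε ] (0ℚ ℚ.< ε × fromℚ ε ≼ x)
    positive-gap 0<x = let (ε , 0<ε , h) = <⇒+fromℚ≼ {0ℝ} 0<x in
      ε , 0<ε , ≼-trans (≼-reflexive λ _ → sym (ℚ.+-identityˡ ε)) h

    0≼weight : ∀ {s} → IsWeight s → ∀ n → 0ℝ ≼ s n
    0≼weight h n = let (ε , 0<ε , ε≼) = positive-gap (proj₁ (h n)) in ≼-trans (0≼fromℚ 0<ε) ε≼

    weight≼½ : ∀ {s} → IsWeight s → ∀ n → s n ≼ ½ℝ
    weight≼½ h n = wrap (proj₂ (h n))

    weight-probabilities : ∀ {s} → IsWeight s → AreProbabilities s
    weight-probabilities {s} h n = 0≼weight {s} h n , ≼-trans (weight≼½ {s} h n) ½≼1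

    ½≼1-weight : ∀ {x} → x ≼ ½ℝ → ½ℝ ≼ 1ℝ - x
    ½≼1-weight {x} h = ≼-from-difference (½ℝ - x) (0≼- h) λ n →
      solve 1 (λ x → con ½ :+ (con ½ :- x) := con 1ℚ :- x) refl (seq x n)

    -- The law is the point mass at X, so a cylinder through X has full measure.
    cylinderMeasure-dirac : ∀ {s} X σ → AreProbabilities s → (∀ n → 1ℝ ≼ bias (s n) (X n)) →
      X Extends σ → 1ℝ ≼ cylinderMeasure s σ
    cylinderMeasure-dirac X [] hs h ext = ≼-refl
    cylinderMeasure-dirac {s} X (b ∷ σ) hs h (refl , ext) = ≼-trans (h 0)
      (≼-trans (≼-reflexive λ n → sym (ℚ.*-identityʳ (seq (bias (s 0) b) n)))
        (*-monoʳ-≼ (bias (s 0) b) (bias-nonneg (hs 0) b)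
          (cylinderMeasure-dirac (X ∘ suc) σ (hs ∘ suc) (h ∘ suc) ext)))

    mass-dirac : ∀ {s} X x → AreProbabilities s → (∀ n → 1ℝ ≼ bias (s n) (X n)) →
      maybe′ (X Extends_) ⊥ x → 1ℝ ≼ mass s x
    mass-dirac X (just σ) = cylinderMeasure-dirac X σ

    splice-isWeight : ∀ N {p q} → IsWeight p → IsWeight q → IsWeight (splice N q p)
    splice-isWeight zero    hp hq n       = hp n
    splice-isWeight (suc N) hp hq zero    = hq 0
    splice-isWeight (suc N) hp hq (suc n) = splice-isWeight N (hp ∘ suc) (hq ∘ suc) n

    splice≼ : ∀ N {p q} → (∀ n → N ℕ.≤ n → p n ≼ q n) → ∀ n → splice N q p n ≼ q n
    splice≼ zero    h n       = h n ℕ.z≤n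
    splice≼ (suc N) h zero    = ≼-refl
    splice≼ (suc N) h (suc n) = splice≼ N (λ n → h (suc n) ∘ ℕ.s≤s) n

    *-mono-≼ : ∀ {a b c d} → 0ℝ ≼ a → 0ℝ ≼ d → a ≼ b → c ≼ d → a * c ≼ b * d
    *-mono-≼ {a} {b} {c} {d} 0≼a 0≼d a≼b c≼d = ≼-trans (*-monoʳ-≼ a 0≼a c≼d)
      (≼-trans (≼-reflexive λ n → ℚ.*-comm (seq a n) (seq d n))
        (≼-trans (*-monoʳ-≼ d 0≼d a≼b) (≼-reflexive λ n → ℚ.*-comm (seq d n) (seq b n))))

    -- The bit weights q 0 and 1 - q 0 are both at least some positive rational ε,
    -- so that d = 1/ε compensates for one modified coordinate.
    cylinderMeasure-splice : ∀ N {p q} → IsWeight p → IsWeight q →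
      ∃[ C ] (0ℚ ℚ.< C × 1ℝ ≼ fromℚ C ×
        (∀ σ → cylinderMeasure p σ ≼ fromℚ C * cylinderMeasure (splice N q p) σ))
    cylinderMeasure-splice zero hp hq = 1ℚ , 0<1ℚ , ≼-refl , λ σ →
      ≼-reflexive λ n → sym (ℚ.*-identityˡ _)
    cylinderMeasure-splice (suc N) {p} {q} hp hq =
      let (C , 0<C , 1≼C , h) = cylinderMeasure-splice N {p ∘ suc} {q ∘ suc} (hp ∘ suc) (hq ∘ suc)
          (ε , 0<ε , ε≼q) = positive-gap (proj₁ (hq 0))
          (d , 0<d , εd≡1) = reciprocalℚ 0<ε
          ε≼bias : ∀ b → fromℚ ε ≼ bias (q 0) b
          ε≼bias = λ { true → ε≼q
                     ; false → ≼-trans ε≼q (≼-trans (weight≼½ {q} hq 0) (½≼1-weight (weight≼½ {q} hq 0))) }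
          1≼d* : ∀ {x} → fromℚ ε ≼ x → 1ℝ ≼ fromℚ d * x
          1≼d* ε≼x = ≼-trans {y = fromℚ d * fromℚ ε} (≼-reflexive λ _ → sym (trans (ℚ.*-comm d ε) εd≡1))
            (*-monoʳ-≼ (fromℚ d) (0≼fromℚ 0<d) ε≼x)
          1≼dC : 1ℝ ≼ fromℚ (d ℚ.* C)
          1≼dC = ≼-trans (1≼d* (≼-trans ε≼q (proj₂ (weight-probabilities {q} hq 0))))
            (≼-trans (*-monoʳ-≼ (fromℚ d) (0≼fromℚ 0<d) 1≼C) (≼-reflexive λ _ → refl))
      in d ℚ.* C , 0<*ℚ 0<d 0<C , 1≼dC , λ
        { [] → ≼-trans 1≼dC (≼-reflexive λ _ → sym (ℚ.*-identityʳ (d ℚ.* C)))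
        ; (b ∷ σ) →
            let R = cylinderMeasure (splice N (q ∘ suc) (p ∘ suc)) σ
                0≼R = cylinderMeasure-nonneg (weight-probabilities
                  {splice N (q ∘ suc) (p ∘ suc)} (splice-isWeight N {p ∘ suc} {q ∘ suc} (hp ∘ suc) (hq ∘ suc))) σ
            in ≼-trans {y = (fromℚ d * bias (q 0) b) * (fromℚ C * R)}
              (*-mono-≼ (bias-nonneg (weight-probabilities {p} hp 0) b) (0≼* (0≼fromℚ 0<C) 0≼R)
                (≼-trans (bias≼1 (weight-probabilities {p} hp 0) b) (1≼d* (ε≼bias b))) (h σ))
              (≼-reflexive λ n → solve 4 (λ d x c r → (d :* x) :* (c :* r) := (d :* c) :* (x :* r)) refl
                d (seq (bias (q 0) b) n) C (seq R n)) }
      where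
      bias≼1 : ∀ {x} → IsProbability x → ∀ b → bias x b ≼ 1ℝ
      bias≼1 (_ , x≼1) true = x≼1
      bias≼1 {x} (0≼x , _) false = ≼-from-difference x 0≼x λ n →
        solve 1 (λ x → con 1ℚ :- x :+ x := con 1ℚ) refl (seq x n)

    null-splice : ∀ N {p q} → IsWeight p → IsWeight q → ∀ {A} → Null (splice N q p) A → Null p A
    null-splice N {p} {q} hp hq {A} null ε 0<ε =
      let (C , 0<C , _ , h) = cylinderMeasure-splice N {p} {q} hp hq
          (d , 0<d , Cd≡1) = reciprocalℚ 0<C
          covering c covers bound = null (d ℚ.* ε) (0<*ℚ 0<d 0<ε)
          mass≼ : ∀ x → mass p x ≼ fromℚ C * mass (splice N q p) x
          mass≼ = λ { (just σ) → h σ ; nothing → ≼-reflexive λ _ → sym (ℚ.*-zeroʳ C) }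
      in covering c covers λ m → ≼-trans (partialSum-scaled (fromℚ C) (λ i → mass≼ (c i)) m)
        (≼-trans (*-monoʳ-≼ (fromℚ C) (0≼fromℚ 0<C) (bound m))
          (≼-reflexive λ _ → trans (sym (ℚ.*-assoc C d ε)) (trans (cong (ℚ._* ε) Cd≡1) (ℚ.*-identityˡ ε))))

  -- Null and measurable filters.

  module Filters (em : ∀ ℓ → ExcludedMiddle ℓ) where

    open Order em
    open OuterMeasure em
    open Markov em
    open Descent em

    2ℚ : ℚ
    2ℚ = 1ℚ ℚ.+ 1ℚ

    abstract

      0<2ℚ : 0ℚ ℚ.< 2ℚ
      0<2ℚ = ℚ.+-mono-< 0<1ℚ 0<1ℚ

      2*½ : ∀ ε → 2ℚ ℚ.* (½ ℚ.* ε) ≡ ε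
      2*½ ε = trans (sym (ℚ.*-assoc 2ℚ ½ ε)) (ℚ.*-identityˡ ε)

      ≽-of-¬≼ : ∀ {x y} → ¬ (x ≼ y) → y ≼ x
      ≽-of-¬≼ {x} {y} h = [ (λ k → ⊥-elim (h k)) , (λ k → k) ]′ (≼-total x y)

      -- The sequence is coupled with itself, and the second cover is empty.
      uncovered : ∀ {s c v δ} → AreProbabilities s → (∀ m → total s c m ≼ v) →
        0ℚ ℚ.< δ → v + fromℚ δ ≼ 1ℝ →
        Σ[ Z ∈ Cantor ] ((∀ n → ¬ (bias (s n) (Z n) ≼ 0ℝ)) × (∀ i → ¬ maybe′ (Z Extends_) ⊥ (c i)))
      uncovered {s} {c} {v} hs bound 0<δ v+δ≼1 =
        let (Z , Z′ , support , avoids , _) = uncovered-pair {λ n → diagonal (s n)} {s} {s} {c} {λ _ → nothing} {v}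
              hs hs (λ n → diagonal-isCoupling (hs n))
              (λ m → ≼-trans (+-monoʳ-≼ (total s c m) (partialSum-zero (λ _ → ≼-refl) m))
                (≼-trans (≼-reflexive λ n → ℚ.+-identityʳ (seq (total s c m) n)) (bound m)))
              0<δ v+δ≼1
        in Z , (λ n → on-diagonal (s n) (Z n) (Z′ n) (support n)) , avoids
        where
        on-diagonal : ∀ p a b → ¬ (diagonal p a b ≼ 0ℝ) → ¬ (bias p a ≼ 0ℝ)
        on-diagonal p true  true  h = h
        on-diagonal p true  false h = ⊥-elim (h ≼-refl)
        on-diagonal p false true  h = ⊥-elim (h ≼-refl)
        on-diagonal p false false h = h

      -- A set X of law p is enlarged at random to a set of law q. If X is in F, so are its
      -- enlargements, and a cover c of F catches the random one for sure. So the conditional mass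
      -- of c given X reaches ½, and by `markov` such X are covered by twice the mass of c.
      null-antitone : ∀ {p q F} → IsWeight p → IsWeight q → (∀ n → p n ≼ q n) →
        (∀ {X Y} → F X → X ⊑ Y → F Y) → Null q F → Null p F
      null-antitone {p} {q} {F} hp hq p≼q upward null ε 0<ε =
        covered-≼ (≼-reflexive λ _ → 2*½ ε)
          (covered-⊆ crosses (markov κ c (fromℚ (½ ℚ.* ε)) bound 0<½ℚ 0<2ℚ refl))
        where
        open Covered (null (½ ℚ.* ε) (0<½*ℚ 0<ε)) renaming (cover to c)

        inverse : ∀ n → ∃[ y ] (0ℝ ≼ y × (1ℝ - p n) * y ≼ 1ℝ × 1ℝ ≼ (1ℝ - p n) * y)
        inverse n = exists-inverse (1ℝ - p n) 0<½ℚ (½≼1-weight (weight≼½ {p} hp n))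

        -- The solution of p + (1 - p) w = q, at most one because q ≤ 1.
        w : ℕ → ℝ
        w n = (q n - p n) * proj₁ (inverse n)

        k : ℕ → Bool → ℝ
        k = monotoneKernel w

        p′ : AreProbabilities p
        p′ = weight-probabilities {p} hp
        q′ : AreProbabilities q
        q′ = weight-probabilities {q} hq

        w-isProbability : ∀ n → IsProbability (w n)
        w-isProbability n = let (y , 0≼y , le , ge) = inverse n in
          0≼* (0≼- (p≼q n)) 0≼y
          , ≼-trans (*-mono-≼ (0≼- (p≼q n)) 0≼y (+-monoˡ-≼ (- p n) (proj₂ (q′ n))) (≼-refl {y})) le

        p+[1-p]w : ∀ n i y → seq (p n) i ℚ.* 1ℚ ℚ.+ (1ℚ ℚ.- seq (p n) i) ℚ.* ((seq (q n) i ℚ.- seq (p n) i) ℚ.* y)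
          ≡ seq (p n) i ℚ.+ (seq (q n) i ℚ.- seq (p n) i) ℚ.* ((1ℚ ℚ.- seq (p n) i) ℚ.* y)
        p+[1-p]w n i y = solve 3 (λ p q y → p :* con 1ℚ :+ (con 1ℚ :- p) :* ((q :- p) :* y) := p :+ (q :- p) :* ((con 1ℚ :- p) :* y))
          refl (seq (p n) i) (seq (q n) i) y

        p+[q-p] : ∀ n i → seq (p n) i ℚ.+ (seq (q n) i ℚ.- seq (p n) i) ℚ.* 1ℚ ≡ seq (q n) i
        p+[q-p] n i = solve 2 (λ p q → p :+ (q :- p) :* con 1ℚ := q) refl (seq (p n) i) (seq (q n) i)

        κ : IsKernel p k q
        κ = record
          { source = p′
          ; kernel = λ { n true → 0≼1 , ≼-refl ; n false → w-isProbability n }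
          ; target = q′
          ; average = λ n → let (y , _ , le , _) = inverse n in
              ≼-trans {y = p n + (q n - p n) * ((1ℝ - p n) * y)} (≼-reflexive λ i → p+[1-p]w n i (seq y i))
                (≼-trans (+-monoʳ-≼ (p n) (*-monoʳ-≼ (q n - p n) (0≼- (p≼q n)) le)) (≼-reflexive λ i → p+[q-p] n i))
          ; average⁻¹ = λ n → let (y , _ , _ , ge) = inverse n in
              ≼-trans {y = p n + (q n - p n) * 1ℝ} (≼-reflexive λ i → sym (p+[q-p] n i))
                (≼-trans (+-monoʳ-≼ (p n) (*-monoʳ-≼ (q n - p n) (0≼- (p≼q n)) ge))
                  (≼-reflexive λ i → sym (p+[1-p]w n i (seq y i)))) }

        crosses : ∀ X → F X → ∃[ m ] ½ℝ ≼ total (λ i → k i (X i)) c m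
        -- Otherwise some Z in the support avoids c; its bits are one wherever those of X are, so Z
        -- is in F and is covered after all.
        crosses X FX = stable λ none →
          let (Z , support , avoids) = uncovered {λ i → k i (X i)} {c} {½ℝ}
                (λ n → IsKernel.kernel κ n (X n))
                (λ m → ≽-of-¬≼ λ h → none (m , h)) 0<½ℚ (≼-reflexive λ _ → refl)
              X⊑Z : X ⊑ Z
              X⊑Z n = above n (X n) (Z n) (support n)
              (i , hit) = covers Z (upward FX X⊑Z)
          in avoids i hit
          where
          above : ∀ n a b → ¬ (bias (k n a) b ≼ 0ℝ) → a ≡ true → b ≡ true
          above n a    true  h e    = refl
          above n true false h refl = ⊥-elim (h (≼-reflexive λ _ → refl))

      -- Fubini by two uses of `markov`. Choose β such that F has no cover of q-mass β, and a cover
      -- c of F of r-mass β ε / 2. Given X in F, the conditional mass of c must reach β / 2: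
      -- otherwise, as c catches `select X Y` for every Y in F, F would have a cover of q-mass β.
      -- The X that reach β / 2 are covered with p-mass ε.
      null-meet : ∀ {p q r F} → AreProbabilities p → AreProbabilities q → AreProbabilities r →
        (A : ℕ → Bool) → (∀ n → A n ≡ true → p n ≼ r n × r n ≼ p n) → (∀ n → A n ≡ false → q n ≼ r n × r n ≼ q n) →
        IsFilter F → Null r F → ¬ Null q F → Null p F
      null-meet {p} {q} {r} {F} p′ q′ r′ A r≈p r≈q filter null-r ¬null-q ε 0<ε =
        let (β , k) = ¬∀⇒∃¬ ¬null-q
            (0<β , ¬cov) = ¬→⇒×¬ k
            0<½β = 0<½*ℚ 0<β
            (d , 0<d , βd≡1) = reciprocalℚ 0<½β
            covering c covers bound = null-r (½ ℚ.* β ℚ.* ε) (0<*ℚ 0<½β 0<ε)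
        in covered-≼ (≼-reflexive λ _ → trans (sym (ℚ.*-assoc d (½ ℚ.* β) ε))
               (trans (cong (ℚ._* ε) (trans (ℚ.*-comm d (½ ℚ.* β)) βd≡1)) (ℚ.*-identityˡ ε)))
             (covered-⊆ (λ X FX → stable λ none → ¬cov (covered-≼ (≼-reflexive λ _ → 2*½ β)
                 (covered-⊆ (crosses c covers X FX)
                   (markov (κ′ X) c (fromℚ (½ ℚ.* β)) (λ m → ≽-of-¬≼ λ h → none (m , h)) 0<½ℚ 0<2ℚ refl))))
               (markov κ c (fromℚ (½ ℚ.* β ℚ.* ε)) bound 0<½β 0<d βd≡1))
        where
        k : ℕ → Bool → ℝ
        k = selectKernel A bit (λ n _ → q n)

        -- Given both X and Y, every weight is zero or one, and the law is the point mass at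
        -- `select X Y`.
        k′ : Cantor → ℕ → Bool → ℝ
        k′ X n b = if A n then bit (X n) else bit b

        k-isProbability : ∀ n b → IsProbability (k n b)
        k-isProbability n b with A n
        ... | true  = bit-isProbability b
        ... | false = q′ n

        k′-isProbability : ∀ X n b → IsProbability (k′ X n b)
        k′-isProbability X n b with A n
        ... | true  = bit-isProbability (X n)
        ... | false = bit-isProbability b

        p*1+ : ∀ (x : ℝ) n → seq x n ℚ.* 1ℚ ℚ.+ (1ℚ ℚ.- seq x n) ℚ.* 0ℚ ≡ seq x n
        p*1+ x n = solve 1 (λ x → x :* con 1ℚ :+ (con 1ℚ :- x) :* con 0ℚ := x) refl (seq x n)

        constant : ∀ (x y : ℝ) n → seq x n ℚ.* seq y n ℚ.+ (1ℚ ℚ.- seq x n) ℚ.* seq y n ≡ seq y n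
        constant x y n = solve 2 (λ x y → x :* y :+ (con 1ℚ :- x) :* y := y) refl (seq x n) (seq y n)

        k-average : ∀ n → p n * k n true + (1ℝ - p n) * k n false ≼ r n ×
                          r n ≼ p n * k n true + (1ℝ - p n) * k n false
        k-average n with A n | r≈p n | r≈q n
        ... | true  | e | _ = ≼-trans (≼-reflexive (p*1+ (p n))) (proj₁ (e refl))
                            , ≼-trans (proj₂ (e refl)) (≼-reflexive λ i → sym (p*1+ (p n) i))
        ... | false | _ | e = ≼-trans (≼-reflexive (constant (p n) (q n))) (proj₁ (e refl))
                            , ≼-trans (proj₂ (e refl)) (≼-reflexive λ i → sym (constant (p n) (q n) i))

        k′-average : ∀ X n → q n * k′ X n true + (1ℝ - q n) * k′ X n false ≼ k n (X n) ×
                             k n (X n) ≼ q n * k′ X n true + (1ℝ - q n) * k′ X n false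
        k′-average X n with A n
        ... | true  = ≼-reflexive (constant (q n) (bit (X n))) , ≼-reflexive λ i → sym (constant (q n) (bit (X n)) i)
        ... | false = ≼-reflexive (p*1+ (q n)) , ≼-reflexive λ i → sym (p*1+ (q n) i)

        κ : IsKernel p k r
        κ = record { source = p′ ; kernel = k-isProbability ; target = r′
                   ; average = proj₁ ∘ k-average ; average⁻¹ = proj₂ ∘ k-average }

        κ′ : ∀ X → IsKernel q (k′ X) (λ n → k n (X n))
        κ′ X = record { source = q′ ; kernel = k′-isProbability X ; target = λ n → k-isProbability n (X n)
                      ; average = proj₁ ∘ k′-average X ; average⁻¹ = proj₂ ∘ k′-average X }

        select : Cantor → Cantor → Cantor
        select X Y n = if A n then X n else Y n

        meet⊑select : ∀ X Y → (λ n → X n ∧ Y n) ⊑ select X Y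
        meet⊑select X Y n h with X n | Y n | A n
        ... | true  | true | true  = refl
        ... | true  | true | false = refl

        dirac : ∀ X Y n → 1ℝ ≼ bias (k′ X n (Y n)) (select X Y n)
        dirac X Y n with A n
        ... | true  = bias-bit (X n)
          where
          bias-bit : ∀ b → 1ℝ ≼ bias (bit b) b
          bias-bit true  = ≼-refl
          bias-bit false = ≼-reflexive λ _ → refl
        ... | false = bias-bit (Y n)
          where
          bias-bit : ∀ b → 1ℝ ≼ bias (bit b) b
          bias-bit true  = ≼-refl
          bias-bit false = ≼-reflexive λ _ → refl

        crosses : ∀ c → Covers c F → ∀ X → F X → ∀ Y → F Y → ∃[ m ] ½ℝ ≼ total (λ i → k′ X i (Y i)) c m
        crosses c covers X FX Y FY =
          let Z = select X Y
              hs : AreProbabilities (λ i → k′ X i (Y i))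
              hs n = k′-isProbability X n (Y n)
              (i , hit) = covers Z (IsFilter.upward filter (IsFilter.meet filter FX FY) (meet⊑select X Y))
          in suc i , ≼-trans ½≼1 (1≼total hs c i (mass-dirac Z (c i) hs (dirac X Y) hit))

      -- The partial sums approach the sum w, and k is a stage at which at most η is missing.
      small-tail : ∀ {s c v} → AreProbabilities s → (∀ m → total s c m ≼ v) → ∀ η → 0ℚ ℚ.< η →
        ∃[ k ] (∀ m → total s (λ i → c (i ℕ.+ k)) m ≼ fromℚ η)
      small-tail {s} {c} {v} hs bound η 0<η =
        let (w , w-sum) = bounded⇒HasSum (mass s ∘ c) v bound
            (k , h) = near w w-sum
        in k , λ m → ≼-from-difference
          ((total s c k + fromℚ η - w) + (w - (total s (λ i → c (i ℕ.+ k)) m + total s c k)))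
          (0≼+ (0≼- h) (0≼- (≼-trans (≼-reflexive λ n → sym (append k m n)) (HasSum-upper {mass s ∘ c} w-sum (m ℕ.+ k)))))
          λ n → solve 4 (λ t p e w → t :+ ((p :+ e :- w) :+ (w :- (t :+ p))) := e) refl
            (seq (total s (λ i → c (i ℕ.+ k)) m) n) (seq (total s c k) n) η (seq w n)
        where
        append : ∀ k m n → seq (total s c (m ℕ.+ k)) n ≡ seq (total s (λ i → c (i ℕ.+ k)) m) n ℚ.+ seq (total s c k) n
        append k zero    n = sym (ℚ.+-identityˡ _)
        append k (suc m) n = trans (cong (ℚ._+ seq (mass s (c (m ℕ.+ k))) n) (append k m n))
          (solve 3 (λ a b c → (a :+ b) :+ c := (a :+ c) :+ b) refl
            (seq (total s (λ i → c (i ℕ.+ k)) m) n) (seq (total s c k) n) (seq (mass s (c (m ℕ.+ k))) n))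

        near : ∀ w → HasSum (mass s ∘ c) w → ∃[ k ] w ≼ total s c k + fromℚ η
        near w w-sum = stable λ none → +fromℚ⋠ {w - fromℚ η} 0<η
          (≼-trans {y = w} (≼-reflexive λ n → solve 2 (λ w e → w :- e :+ e := w) refl (seq w n) η)
            (HasSum-least {mass s ∘ c} w-sum λ m → ≼-from-difference (w - (total s c m + fromℚ η))
              (0≼- (≽-of-¬≼ λ h → none (m , h)))
              λ n → solve 3 (λ t e w → t :+ (w :- (t :+ e)) := w :- e) refl (seq (total s c m) n) η (seq w n)))

      extends-agree : ∀ {X Y} σ → (∀ n → n ℕ.< length σ → X n ≡ Y n) → X Extends σ → Y Extends σ
      extends-agree []      h ext       = tt
      extends-agree (b ∷ σ) h (e , ext) = trans (sym (h 0 (ℕ.s≤s ℕ.z≤n))) e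
                                        , extends-agree σ (λ n → h (suc n) ∘ ℕ.s≤s) ext

      wordLength≤maxLength : ∀ c {i k} → i ℕ.< k → wordLength (c i) ℕ.≤ maxLength c k
      wordLength≤maxLength c {i} {suc k} (ℕ.s≤s i≤k) = case ℕ.m≤n⇒m<n∨m≡n i≤k of λ
        { (inj₁ i<k)  → ℕ.≤-trans (wordLength≤maxLength c i<k) (ℕ.m≤m⊔n (maxLength c k) _)
        ; (inj₂ refl) → ℕ.m≤n⊔m (maxLength c k) _ }

      -- Each n below L either lies in every member or is removed by a meet with a member that omits
      -- it. After finitely many meets, what remains of X is a member contained in every member, and
      -- so it generates F.
      finite-member⇒principal : ∀ {F} → IsFilter F → ∀ {X} → F X → ∀ L →
        (∀ n → X n ≡ true → n ℕ.< L) → Principal F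
      finite-member⇒principal {F} filter {X} FX L X<L =
        let (A , FA , h) = core L
            B = λ n → A n ∧ X n
            FB = meet FA FX
        in B , λ Y → mk⇔
          (λ FY n e → h n (X<L n (∧-right (A n) (X n) e)) (∧-left (A n) (X n) e) Y FY)
          (λ B⊑Y → upward FB B⊑Y)
        where
        open IsFilter filter
        ∧-left : ∀ a b → a ∧ b ≡ true → a ≡ true
        ∧-left true b e = refl
        ∧-right : ∀ a b → a ∧ b ≡ true → b ≡ true
        ∧-right true b e = e
        false≢true : ∀ {b} → b ≡ false → ¬ (b ≡ true)
        false≢true refl ()

        core : ∀ l → Σ[ A ∈ Cantor ] (F A × (∀ n → n ℕ.< l → A n ≡ true → ∀ Y → F Y → Y n ≡ true))
        core zero    = (λ _ → true) , whole , λ _ ()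
        core (suc l) = let (A , FA , h) = core l in
          case em 0ℓ {Σ[ Y ∈ Cantor ] (F Y × Y l ≡ false)} of λ
          { (yes (Y , FY , Yl)) → (λ n → A n ∧ Y n) , meet FA FY , λ n n<1+l e →
              case ℕ.m≤n⇒m<n∨m≡n (ℕ.s≤s⁻¹ n<1+l) of λ
              { (inj₁ n<l)  → h n n<l (∧-left (A n) (Y n) e)
              ; (inj₂ refl) → ⊥-elim (false≢true Yl (∧-right (A n) (Y n) e)) }
          ; (no none) → A , FA , λ n n<1+l e Y FY →
              case ℕ.m≤n⇒m<n∨m≡n (ℕ.s≤s⁻¹ n<1+l) of λ
              { (inj₁ n<l)  → h n n<l e Y FY
              ; (inj₂ refl) → not-false (Y n) λ Yn → none (Y , FY , Yn) } }
          where
          not-false : ∀ b → ¬ (b ≡ false) → b ≡ true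
          not-false true  h = refl
          not-false false h = ⊥-elim (h refl)

      -- L bounds the length of the first k words of the cover c of the complement, and the
      -- others have small mass.  So it is enough that Z₁ avoids all of c and Z₂ the others:
      -- the two agree below L.
      measurable⇒null : ∀ {r F} → (∀ n → 0ℝ ≼ r n) → (∀ n → r n ≼ ½ℝ) →
        IsNonprincipalFilter F → Measurable r F → Null r F
      measurable⇒null {r} {F} 0≼r r≼½ nonpr meas = stable λ ¬null →
        let (δ , v , 0<δ , cov , v+δ≼1) = measurable∧¬null⇒complement meas ¬null in
        no-cover δ v 0<δ v+δ≼1 cov
        where
        open IsNonprincipalFilter nonpr
        r′ : AreProbabilities r
        r′ n = 0≼r n , ≼-trans (r≼½ n) ½≼1

        joint : ℕ → ℕ → Bool → Bool → ℝ
        joint L n = if n ℕ.<ᵇ L then diagonal (r n) else disjoint (r n)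

        joint-isCoupling : ∀ L n → IsCoupling (joint L n) (r n) (r n)
        joint-isCoupling L n with n ℕ.<ᵇ L
        ... | true  = diagonal-isCoupling (r′ n)
        ... | false = disjoint-isCoupling (0≼r n) (r≼½ n)

        equal-below : ∀ L (Z₁ Z₂ : Cantor) → (∀ n → ¬ (joint L n (Z₁ n) (Z₂ n) ≼ 0ℝ)) → ∀ n → n ℕ.< L → Z₁ n ≡ Z₂ n
        equal-below L Z₁ Z₂ support n n<L = go (n ℕ.<ᵇ L) (ℕ.<⇒<ᵇ n<L) (Z₁ n) (Z₂ n) (support n)
          where
          go : ∀ t → T t → ∀ a b → ¬ ((if t then diagonal (r n) else disjoint (r n)) a b ≼ 0ℝ) → a ≡ b
          go true _ true  true  h = refl
          go true _ true  false h = ⊥-elim (h ≼-refl)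
          go true _ false true  h = ⊥-elim (h ≼-refl)
          go true _ false false h = refl

        disjoint-above : ∀ L (Z₁ Z₂ : Cantor) → (∀ n → ¬ (joint L n (Z₁ n) (Z₂ n) ≼ 0ℝ)) →
          ∀ n → Z₁ n ∧ Z₂ n ≡ true → n ℕ.< L
        disjoint-above L Z₁ Z₂ support n e =
          ℕ.<ᵇ⇒< n L (go (n ℕ.<ᵇ L) (Z₁ n) (Z₂ n) (support n) e)
          where
          go : ∀ t a b → ¬ ((if t then diagonal (r n) else disjoint (r n)) a b ≼ 0ℝ) → a ∧ b ≡ true → T t
          go true  a    b    h e = tt
          go false true true h e = ⊥-elim (h ≼-refl)

        agree : ∀ {X Y} x → (∀ n → n ℕ.< wordLength x → X n ≡ Y n) →
          maybe′ (X Extends_) ⊥ x → maybe′ (Y Extends_) ⊥ x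
        agree (just σ) = extends-agree σ

        split-cover : ∀ {c} → Covers c (∁ F) → ∀ k (Z₁ Z₂ : Cantor) →
          (∀ n → ¬ (joint (maxLength c k) n (Z₁ n) (Z₂ n) ≼ 0ℝ)) →
          (∀ i → ¬ maybe′ (Z₁ Extends_) ⊥ (c i)) → (∀ i → ¬ maybe′ (Z₂ Extends_) ⊥ (c (i ℕ.+ k))) → ⊥
        split-cover {c} covers k Z₁ Z₂ support avoids₁ avoids₂ =
          nonprincipal (finite-member⇒principal isFilter (IsFilter.meet isFilter FZ₁ FZ₂) (maxLength c k)
            (disjoint-above (maxLength c k) Z₁ Z₂ support))
          where
          FZ₁ : F Z₁
          FZ₁ = stable λ ¬F → let (i , hit) = covers Z₁ ¬F in avoids₁ i hit

          not-hit : ∀ i → ¬ maybe′ (Z₂ Extends_) ⊥ (c i)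
          not-hit i hit = case ℕ.≤-<-connex k i of λ
            { (inj₁ k≤i) → avoids₂ (i ℕ.∸ k)
                (subst (λ j → maybe′ (Z₂ Extends_) ⊥ (c j)) (sym (ℕ.m∸n+n≡m k≤i)) hit)
            ; (inj₂ i<k) → avoids₁ i (agree (c i) (λ n l →
                sym (equal-below (maxLength c k) Z₁ Z₂ support n (ℕ.<-≤-trans l (wordLength≤maxLength c i<k)))) hit) }

          FZ₂ : F Z₂
          FZ₂ = stable λ ¬F → let (i , hit) = covers Z₂ ¬F in not-hit i hit

        no-cover : ∀ δ v → 0ℚ ℚ.< δ → v + fromℚ δ ≼ 1ℝ → ¬ Covered r (∁ F) v
        no-cover δ v 0<δ v+δ≼1 (covering c covers bound) =
          -- Half of δ goes to the tail, and the other half is the gap left below one.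
          let (k , tail) = small-tail {r} {c} {v} r′ bound (½ ℚ.* δ) (0<½*ℚ 0<δ)
              (Z₁ , Z₂ , support , avoids₁ , avoids₂) = uncovered-pair
                {joint (maxLength c k)} {r} {r} {c} {λ i → c (i ℕ.+ k)} {v + fromℚ (½ ℚ.* δ)} {½ ℚ.* δ}
                r′ r′ (joint-isCoupling (maxLength c k)) (λ m → +-mono-≼ (bound m) (tail m)) (0<½*ℚ 0<δ)
                (≼-trans (≼-reflexive λ n → trans (ℚ.+-assoc (seq v n) (½ ℚ.* δ) (½ ℚ.* δ))
                  (cong (seq v n ℚ.+_) (½+½ δ))) v+δ≼1)
          in split-cover covers k Z₁ Z₂ support avoids₁ avoids₂

      -- A consists of the n with p n ≤ q n. The decision is an argument of `on-true` and
      -- `on-false`, so that matching on it evaluates `does`.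
      ⊓-selects : ∀ {p q r : ℕ → ℝ} → (∀ n → r n ≈ p n ⊓ q n) → Σ[ A ∈ (ℕ → Bool) ]
        ((∀ n → A n ≡ true → p n ≼ r n × r n ≼ p n) × (∀ n → A n ≡ false → q n ≼ r n × r n ≼ q n))
      ⊓-selects {p} {q} {r} r≈ = (λ n → does (em 0ℓ {p n ≼ q n}))
        , (λ n → on-true n (em 0ℓ)) , λ n → on-false n (em 0ℓ)
        where
        on-true : ∀ n (d : Dec (p n ≼ q n)) → does d ≡ true → p n ≼ r n × r n ≼ p n
        on-true n (yes h) _ = ≼-trans (≼-⊓ h) (wrap (proj₂ (r≈ n))) , ≼-trans {y = p n ⊓ q n} (wrap (proj₁ (r≈ n))) ⊓≼ˡ
        on-false : ∀ n (d : Dec (p n ≼ q n)) → does d ≡ false → q n ≼ r n × r n ≼ q n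
        on-false n (no h) _ = ≼-trans (≼-⊓′ (≽-of-¬≼ h)) (wrap (proj₂ (r≈ n))) , ≼-trans {y = p n ⊓ q n} (wrap (proj₁ (r≈ n))) ⊓≼ʳ

open NullFilters

theorem1p3 : (∀ ℓ → ExcludedMiddle ℓ) →
    (F : Pred Cantor 0ℓ) → IsNonprincipalFilter F →
    ((p q : ℕ → ℝ) → IsWeight p → IsWeight q →
    (∃[ N ] (∀ n → N ℕ.≤ n → p n ≤ q n)) →
    HasMeasure q F 0ℝ → HasMeasure p F 0ℝ)
    ×
    ((p q r : ℕ → ℝ) → IsWeight p → IsWeight q →
    (∀ n → r n ≈ p n ⊓ q n) →
    ¬ Measurable p F → ¬ Measurable q F → ¬ Measurable r F)
theorem1p3 em F nonpr = part₁ , part₂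
  where
  open IsNonprincipalFilter nonpr
  open Order em
  open OuterMeasure em
  open Filters em

  part₁ : (p q : ℕ → ℝ) → IsWeight p → IsWeight q → (∃[ N ] (∀ n → N ℕ.≤ n → p n ≤ q n)) →
    HasMeasure q F 0ℝ → HasMeasure p F 0ℝ
  -- Replacing the weights of p below N by those of q gives p ≤ q everywhere, and sets null for the
  -- new measure are null for p.
  part₁ p q hp hq (N , p≤q) null = null⇒measureZero (null-splice N {p} {q} hp hq
    (null-antitone {splice N q p} {q} (splice-isWeight N {p} {q} hp hq) hq
      (splice≼ N λ n N≤n → wrap (p≤q n N≤n)) (IsFilter.upward isFilter) (measureZero⇒null null)))

  part₂ : (p q r : ℕ → ℝ) → IsWeight p → IsWeight q → (∀ n → r n ≈ p n ⊓ q n) →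
    ¬ Measurable p F → ¬ Measurable q F → ¬ Measurable r F
  -- If F were measurable for r, it would be null for r. As it is not null for q, it would be null
  -- for p, hence measurable for p.
  part₂ p q r hp hq r≈ ¬meas-p ¬meas-q meas-r = ¬meas-p (null⇒measurable
    (null-meet {p} {q} {r} p′ q′ (λ n → 0≼r n , ≼-trans (r≼½ n) ½≼1) A on-A off-A isFilter
      (measurable⇒null 0≼r r≼½ nonpr meas-r) (¬meas-q ∘ null⇒measurable)))
    where
    p′ = weight-probabilities {p} hp
    q′ = weight-probabilities {q} hq
    selection = ⊓-selects {p} {q} {r} r≈
    A = proj₁ selection
    on-A = proj₁ (proj₂ selection)
    off-A = proj₂ (proj₂ selection)

    0≼r : ∀ n → 0ℝ ≼ r n
    0≼r n = ≼-trans {y = p n ⊓ q n}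
      ([ (λ p≼q → ≼-trans (0≼weight {p} hp n) (≼-⊓ p≼q))
       , (λ q≼p → ≼-trans (0≼weight {q} hq n) (≼-⊓′ q≼p)) ]′ (≼-total (p n) (q n)))
      (wrap (proj₂ (r≈ n)))
    r≼½ : ∀ n → r n ≼ ½ℝ
    r≼½ n = ≼-trans {y = p n ⊓ q n} (wrap (proj₁ (r≈ n))) (≼-trans ⊓≼ˡ (weight≼½ {p} hp n))
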